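{- Let $\mathcal{H}$ be any set of infinitely edge-connected graphs such that every infinitely edge-connected graph has a minor in $\mathcal{H}$ and no element of $\mathcal{H}$ is a minor of another element of $\mathcal{H}$. Then $\mathcal{H}$ consists of exactly two graphs, one of which is minor-equivalent to the Farey graph and the other of which is minor-equivalent to $T_{\aleph_0} * t$.
   Context: Graphs are simple and may be infinite. A graph is infinitely edge-connected if no two distinct vertices can be separated by deleting finitely many edges. A graph $H$ is a minor of $G$ if there are disjoint non-empty vertex sets $V_h\subseteq V(G)$ ($h\in V(H)$), each inducing a connected subgraph of $G$, such that $G$ has a $V_h$–$V_{h'}$ edge whenever $hh'\in E(H)$. Two graphs are minor-equivalent if each is a minor of the other. The Farey graph is the graph on $\mathbb{Q}\cup\{\infty\}$ in which $a/b$ and $c/d$ in lowest terms (with $\infty=(\pm1)/0$) are adjacent iff $ad-bc=\pm1$. $T_{\aleph_0}$ is the tree in which every vertex has countably infinite degree, and $T_{\aleph_0}*t$ is obtained from it by adding a new vertex $t$ adjacent to all its vertices.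
   Formalization: Infinitely edge-connected graphs are here required to have at least two vertices; otherwise the one-vertex graph would count and the set consisting of it alone would be a counterexample. -}

module Defs where

open import Level using (0ℓ)
open import Data.Nat using (ℕ)
open import Data.Integer as ℤ using (ℤ; ∣_∣; _-_; _*_)
open import Data.Integer.Properties using (∣i-j∣≡∣j-i∣; i≡j⇒i-j≡0)
open import Data.Rational using (ℚ; ↥_; ↧_)
open import Data.Maybe using (Maybe; just; nothing)
open import Data.List using (List; []; _∷_)
open import Data.Product using (Σ; _×_; _,_)
open import Data.Sum using (_⊎_)
open import Data.Empty using (⊥)
open import Data.Unit using (⊤)
open import Relation.Nullary using (¬_)
open import Relation.Binary.PropositionalEquality using (_≡_; _≢_; refl; sym; trans; cong)

record Graph : Set₁ where
  field
    V     : Set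
    _~_   : V → V → Set
    ~-sym : ∀ {x y} → x ~ y → y ~ x
    ~-irr : ∀ {x} → ¬ (x ~ x)

open Graph public

data Walk (G : Graph) (S : V G → Set) (OK : V G → V G → Set)
          : V G → V G → Set where
  stay : ∀ {x} → S x → Walk G S OK x x
  step : ∀ {x y z} → S x → _~_ G x y → OK x y → Walk G S OK y z →
         Walk G S OK x z

data EdgeIn {A : Set} (x y : A) : List (A × A) → Set where
  here-xy : ∀ {F} → EdgeIn x y ((x , y) ∷ F)
  here-yx : ∀ {F} → EdgeIn x y ((y , x) ∷ F)
  there   : ∀ {p F} → EdgeIn x y F → EdgeIn x y (p ∷ F)

InfEdgeConnected : Graph → Set
InfEdgeConnected G =
  Σ (V G) (λ a → Σ (V G) (λ b → a ≢ b)) ×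
  ((F : List (V G × V G)) (u v : V G) → u ≢ v →
     Walk G (λ _ → ⊤) (λ x y → ¬ EdgeIn x y F) u v)

record _≼_ (H G : Graph) : Set₁ where
  field
    branch    : V H → V G → Set
    disjoint  : ∀ {h h' x} → branch h x → branch h' x → h ≡ h'
    nonempty  : ∀ h → Σ (V G) (branch h)
    connected : ∀ h {x y} → branch h x → branch h y →
                Walk G (branch h) (λ _ _ → ⊤) x y
    edges     : ∀ {h h'} → _~_ H h h' →
                Σ (V G) (λ x → Σ (V G) (λ y →
                  branch h x × branch h' y × _~_ G x y))

_≈m_ : Graph → Graph → Set₁
H ≈m G = (H ≼ G) × (G ≼ H)

-- The Farey graph on ℚ ∪ {∞}; nothing = ∞ = 1/0.
-- A rational in lowest terms is (↥ q)/(↧ q) with ↧ q > 0.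

num den : Maybe ℚ → ℤ
num (just q) = ↥ q
num nothing  = ℤ.+ 1
den (just q) = ↧ q
den nothing  = ℤ.+ 0

FareyAdj : Maybe ℚ → Maybe ℚ → Set
FareyAdj p q = ∣ num p * den q - num q * den p ∣ ≡ 1

Farey : Graph
Farey = record
  { V = Maybe ℚ
  ; _~_ = FareyAdj
  ; ~-sym = λ {p} {q} e → trans (∣i-j∣≡∣j-i∣ (num q * den p) (num p * den q)) e
  ; ~-irr = λ {p} e → irr p e
  }
  where
  irr : ∀ p → ¬ FareyAdj p p
  irr p e with trans (sym (cong ∣_∣ (i≡j⇒i-j≡0 {num p * den p} refl))) e
  ... | ()

-- T_ℵ₀: vertices are finite sequences of naturals (the root is []);
-- the children of x are n ∷ x for n : ℕ.  Every vertex has countably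
-- infinitely many neighbours.

data TAdj : List ℕ → List ℕ → Set where
  down : ∀ n x → TAdj x (n ∷ x)
  up   : ∀ n x → TAdj (n ∷ x) x

T-ℵ₀ : Graph
T-ℵ₀ = record
  { V = List ℕ
  ; _~_ = TAdj
  ; ~-sym = λ { (down n x) → up n x ; (up n x) → down n x }
  ; ~-irr = λ ()
  }

data TtAdj : Maybe (List ℕ) → Maybe (List ℕ) → Set where
  tree  : ∀ {x y} → TAdj x y → TtAdj (just x) (just y)
  apexˡ : ∀ x → TtAdj nothing (just x)
  apexʳ : ∀ x → TtAdj (just x) nothing

T-ℵ₀*t : Graph
T-ℵ₀*t = record
  { V = Maybe (List ℕ)
  ; _~_ = TtAdj
  ; ~-sym = λ { (tree e) → tree (~-sym T-ℵ₀ e) ; (apexˡ x) → apexʳ x ; (apexʳ x) → apexˡ x }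
  ; ~-irr = λ { (tree e) → ~-irr T-ℵ₀ e }
  }

{-# OPTIONS --safe #-}

-- Call a set iec if no finite edge cut of its induced subgraph separates two of its vertices.
-- In an infinitely edge-connected G fix a root z and look at sets D, avoiding z, none of whose
-- vertices can be cut off from z by finitely many edges.  The class of u ∈ D (the vertices not
-- finitely separable from u in D) either has a finite edge boundary, and is then iec and
-- contains infinitely many neighbours of z, or it has infinitely many leaving edges, which
-- yield infinitely many disjoint pieces with finite boundary hanging off a connected part of
-- the class; each piece again cannot be cut off from z.  If such scattering can always be
-- continued (possibly after enlarging the apex), it produces T-ℵ₀*t.  Otherwise take a place
-- where it cannot.  There one finds zones: iec sets E with outside vertices a and b that both
-- have infinitely many neighbours in E.  Deleting a vertex w of E next to a keeps b and w
-- attached to one class C of E − w.  Either a is attached to another class or spreads over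
-- pieces outside C, so that the zone splits into a zone between a and w and one between w and
-- b; or a stays attached to C.  If every zone splits, the splittings follow the Stern–Brocot
-- subdivision and give the Farey graph; in a zone that never splits, every deleted vertex
-- remains attached, and T-ℵ₀*t with apex a can be built greedily.
--
-- The Farey graph is no minor of T-ℵ₀*t, for it has two disjoint triangles, and the one whose
-- branch sets avoid t would be a minor of a tree; T-ℵ₀*t is no minor of the Farey graph because
-- it contains K₂,₃, while Farey edges do not cross on the circle.

module Submission where

open import Defs
open import Level using (0ℓ)
open import Axiom.ExcludedMiddle using (ExcludedMiddle)
open import Data.Bool as Bool using (Bool; true; false; T)
open import Data.Empty using (⊥; ⊥-elim)
open import Data.Integer as ℤ using (ℤ; +_; -[1+_]; +[1+_]; +0; _⊖_; ∣_∣)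
import Data.Integer.Properties as ℤₚ
import Data.Integer.Solver as ℤ-Solver
open import Data.List using (List; []; _∷_; _++_; map; concatMap; length)
open import Data.List.Membership.Propositional renaming (_∈_ to _∈ₗ_; _∉_ to _∉ₗ_)
open import Data.List.Membership.Propositional.Properties using (∈-++⁺ˡ; ∈-++⁺ʳ)
open import Data.List.Relation.Unary.All as All using (All; []; _∷_)
open import Data.List.Relation.Unary.Any using (here; there)
open import Data.Maybe as Maybe using (Maybe; just; nothing)
import Data.Maybe.Properties as Maybeₚ
open import Data.Nat as ℕ using (ℕ; zero; suc; _+_; _*_)
open import Data.Nat.Coprimality as Coprimality using (Coprime; recompute)
open import Data.Nat.Divisibility using
  (_∣_; ∣m∣n⇒∣m+n; ∣-refl; _∣0; ∣m+n∣m⇒∣n; ∣n⇒∣m*n; ∣m⇒∣m*n; ∣1⇒≡1)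
import Data.Nat.Properties as ℕₚ
open import Data.Nat.Solver using (module +-*-Solver)
open import Data.Product using (Σ; ∃; _×_; _,_; proj₁; proj₂)
open import Data.Rational as ℚ using (ℚ; mkℚ)
import Data.Rational.Properties as ℚₚ
open import Data.Sum as Sum using (_⊎_; inj₁; inj₂; [_,_]′)
open import Data.Unit using (⊤; tt)
open import Function using (_∘_; id)
open import Relation.Binary using (tri<; tri≈; tri>; Trichotomous)
open import Relation.Binary.Construct.Add.Supremum.Strict ℚ._<_
  using (_<⁺_; [_]; [_]<⊤⁺; <⁺-trans; <⁺-cmp-≡; <⁺-irrefl-≡)
open import Relation.Binary.PropositionalEquality
  using (_≡_; _≢_; refl; sym; trans; cong; cong₂; subst; subst₂)
open import Relation.Nullary using (¬_; Dec; yes; no)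
open import Relation.Nullary.Decidable using (⌊_⌋; toWitness; fromWitness)

-- Walks and finite edge sets

infixr 5 _▷_
_▷_ : ∀ {G S OK x y z} → Walk G S OK x y → Walk G S OK y z → Walk G S OK x z
stay _       ▷ w′ = w′
step h e n w ▷ w′ = step h e n (w ▷ w′)

start : ∀ {G S OK x y} → Walk G S OK x y → S x
start (stay h)       = h
start (step h _ _ _) = h

finish : ∀ {G S OK x y} → Walk G S OK x y → S y
finish (stay h)       = h
finish (step _ _ _ w) = finish w

reverse : ∀ {G S OK} → (∀ {x y} → OK x y → OK y x) → ∀ {x y} → Walk G S OK x y → Walk G S OK y x
reverse sw (stay h)               = stay h
reverse {G} sw (step h e n w) = reverse sw w ▷ step (start w) (~-sym G e) (sw n) (stay h)

edge-swap : ∀ {A : Set} {x y : A} {F} → EdgeIn x y F → EdgeIn y x F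
edge-swap here-xy   = here-yx
edge-swap here-yx   = here-xy
edge-swap (there e) = there (edge-swap e)

ends : ∀ {A : Set} → List (A × A) → List A
ends []            = []
ends ((x , y) ∷ F) = x ∷ y ∷ ends F

edge-end : ∀ {A : Set} {x y : A} {F} → EdgeIn x y F → x ∈ₗ ends F
edge-end here-xy   = here refl
edge-end here-yx   = there (here refl)
edge-end (there e) = there (there (edge-end e))

-- Subsets, finite cuts, classes and scattering

module Sets (em : ExcludedMiddle 0ℓ) (G : Graph) where

  Vx : Set
  Vx = V G

  infix 4 _~ᴳ_ _∈_ _∉_ _⊆_ _⊑_
  infixl 6 _∪_ _∖_ _−_

  _~ᴳ_ : Vx → Vx → Set
  _~ᴳ_ = _~_ G

  -- Subsets are Boolean-valued so that they can be quantified over inside Set,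
  -- where em applies.
  Sub : Set
  Sub = Vx → Bool

  record _∈_ (x : Vx) (D : Sub) : Set where
    constructor mem
    field unmem : T (D x)

  _∉_ : Vx → Sub → Set
  x ∉ D = ¬ x ∈ D

  ⟦_⟧ : (Vx → Set) → Sub
  ⟦ P ⟧ x = ⌊ em {P x} ⌋

  intro : ∀ {P : Vx → Set} {x} → P x → x ∈ ⟦ P ⟧
  intro p = mem (fromWitness p)

  elim : ∀ {P : Vx → Set} {x} → x ∈ ⟦ P ⟧ → P x
  elim (mem t) = toWitness t

  dne : {P : Set} → ¬ ¬ P → P
  dne {P} nn with em {P}
  ... | yes p = p
  ... | no np = ⊥-elim (nn np)

  ¬∀⇒∃¬ : {A : Set} {P : A → Set} → ¬ (∀ a → P a) → ∃ λ a → ¬ P a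
  ¬∀⇒∃¬ {A} {P} h = dne λ n → h λ a → dne λ np → n (a , np)

  _⊆_ : Sub → Sub → Set
  A ⊆ B = ∀ {x} → x ∈ A → x ∈ B

  Disj : Sub → Sub → Set
  Disj A B = ∀ {x} → x ∈ A → x ∈ B → ⊥

  _∪_ _∖_ : Sub → Sub → Sub
  A ∪ B = ⟦ (λ x → x ∈ A ⊎ x ∈ B) ⟧
  A ∖ B = ⟦ (λ x → x ∈ A × x ∉ B) ⟧

  ｛_｝ : Vx → Sub
  ｛ v ｝ = ⟦ (λ x → x ≡ v) ⟧

  _−_ : Sub → Vx → Sub
  D − v = D ∖ ｛ v ｝

  ∪ˡ : ∀ {A B} → A ⊆ A ∪ B
  ∪ˡ = intro ∘ inj₁

  ∪ʳ : ∀ {A B} → B ⊆ A ∪ B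
  ∪ʳ = intro ∘ inj₂

  ∪-elim : ∀ {A B} {R : Vx → Set} → (∀ {x} → x ∈ A → R x) → (∀ {x} → x ∈ B → R x) →
           ∀ {x} → x ∈ A ∪ B → R x
  ∪-elim f g = [ f , g ]′ ∘ elim

  ∖-⊆ : ∀ {A B} → A ∖ B ⊆ A
  ∖-⊆ = proj₁ ∘ elim

  ∖-∉ : ∀ {A B x} → x ∈ A ∖ B → x ∉ B
  ∖-∉ = proj₂ ∘ elim

  self : ∀ {v} → v ∈ ｛ v ｝
  self = intro refl

  −-≢ : ∀ {D v x} → x ∈ D − v → x ≢ v
  −-≢ h refl = ∖-∉ h self

  −-intro : ∀ {D v x} → x ∈ D → x ≢ v → x ∈ D − v
  −-intro h n = intro (h , n ∘ elim)

  ｛｝-⊆ : ∀ {v D} → v ∈ D → ｛ v ｝ ⊆ D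
  ｛｝-⊆ {v} {D} h e = subst (_∈ D) (sym (elim e)) h

  Edges : Set
  Edges = List (Vx × Vx)

  _⊑_ : Edges → Edges → Set
  F ⊑ F′ = ∀ {x y} → EdgeIn x y F → EdgeIn x y F′

  ⊑-++ˡ : ∀ {F F′} → F ⊑ F ++ F′
  ⊑-++ˡ here-xy   = here-xy
  ⊑-++ˡ here-yx   = here-yx
  ⊑-++ˡ (there e) = there (⊑-++ˡ e)

  ⊑-++ʳ : ∀ F {F′} → F′ ⊑ F ++ F′
  ⊑-++ʳ []      e = e
  ⊑-++ʳ (_ ∷ F) e = there (⊑-++ʳ F e)

  star : Vx → List Vx → Edges
  star z = map (λ v → v , z)

  star-edge : ∀ {z v L} → v ∈ₗ L → EdgeIn v z (star z L)
  star-edge (here refl) = here-xy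
  star-edge (there i)   = there (star-edge i)

  Reach : Sub → Edges → Vx → Vx → Set
  Reach D F = Walk G (_∈ D) (λ x y → ¬ EdgeIn x y F)

  edge-reach : ∀ {D F x y} → x ∈ D → y ∈ D → x ~ᴳ y → ¬ EdgeIn x y F → Reach D F x y
  edge-reach x∈ y∈ e n = step x∈ e n (stay y∈)

  turn : ∀ {D F x y} → Reach D F x y → Reach D F y x
  turn = reverse (λ n → n ∘ edge-swap)

  mono : ∀ {D D′ F F′ x y} → D ⊆ D′ → F′ ⊑ F → Reach D F x y → Reach D′ F′ x y
  mono i j (stay h)       = stay (i h)
  mono i j (step h e n w) = step (i h) e (n ∘ j) (mono i j w)

  confine : ∀ {D F} (C : Sub) →
    (∀ {a b} → a ∈ C → b ∈ D → a ~ᴳ b → ¬ EdgeIn a b F → b ∈ C) →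
    ∀ {x y} → x ∈ C → Reach D F x y → Reach C F x y
  confine C cl x∈ (stay _)       = stay x∈
  confine C cl x∈ (step _ e n w) = step x∈ e n (confine C cl (cl x∈ (start w) e n) w)

  first-hit : ∀ {D F x y} (C : Sub) → Reach D F x y → x ∉ C → y ∈ C →
    ∃ λ p → ∃ λ q → Reach (D ∖ C) F x p × p ~ᴳ q × ¬ EdgeIn p q F × q ∈ C × q ∈ D
  first-hit C (stay _) x∉ y∈ = ⊥-elim (x∉ y∈)
  first-hit C (step {y = y} h e n w) x∉ z∈ with em {y ∈ C}
  ... | yes y∈ = _ , y , stay (intro (h , x∉)) , e , n , y∈ , start w
  ... | no  y∉ with first-hit C w y∉ z∈
  ...   | p , q , w′ , rest = p , q , step (intro (h , x∉)) e n w′ , rest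

  Conn : Sub → Set
  Conn D = ∀ {x y} → x ∈ D → y ∈ D → Reach D [] x y

  none : ∀ {x y : Vx} → ¬ EdgeIn x y []
  none ()

  conn-｛｝ : ∀ {v} → Conn ｛ v ｝
  conn-｛｝ x∈ y∈ with elim x∈ | elim y∈
  ... | refl | refl = stay x∈

  conn-join : ∀ {A B a b} → Conn A → Conn B → a ∈ A → b ∈ B →
    Reach (A ∪ B) [] a b → Conn (A ∪ B)
  conn-join {A} {B} {a} cA cB a∈ b∈ w x∈ y∈ = turn (to x∈) ▷ to y∈
    where
    to : ∀ {x} → x ∈ A ∪ B → Reach (A ∪ B) [] a x
    to = ∪-elim (λ h → mono ∪ˡ id (cA a∈ h)) (λ h → w ▷ mono ∪ʳ id (cB b∈ h))

  conn-edge : ∀ {A B a b} → Conn A → Conn B → a ∈ A → b ∈ B → a ~ᴳ b → Conn (A ∪ B)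
  conn-edge cA cB a∈ b∈ e =
    conn-join cA cB a∈ b∈ (edge-reach (∪ˡ a∈) (∪ʳ b∈) e none)

  conn-meet : ∀ {A B a} → Conn A → Conn B → a ∈ A → a ∈ B → Conn (A ∪ B)
  conn-meet cA cB a∈ a∈′ = conn-join cA cB a∈ a∈′ (stay (∪ˡ a∈))

  Comp : Sub → Edges → Vx → Sub
  Comp D F u = ⟦ Reach D F u ⟧

  comp-⊆ : ∀ {D F u} → Comp D F u ⊆ D
  comp-⊆ = finish ∘ elim

  comp-self : ∀ {D F u} → u ∈ D → u ∈ Comp D F u
  comp-self = intro ∘ stay

  comp-anti : ∀ {D F F′ u} → F ⊑ F′ → Comp D F′ u ⊆ Comp D F u
  comp-anti i h = intro (mono id i (elim h))

  comp-closed : ∀ {D F u a b} → a ∈ Comp D F u → b ∈ D → a ~ᴳ b → ¬ EdgeIn a b F →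
    b ∈ Comp D F u
  comp-closed a∈ b∈ e n = intro (elim a∈ ▷ edge-reach (comp-⊆ a∈) b∈ e n)

  comp-confine : ∀ {D F F′ F″ u x y} → F ⊑ F″ → F′ ⊑ F″ → x ∈ Comp D F u →
    Reach D F″ x y → Reach (Comp D F u) F′ x y
  comp-confine i j x∈ w =
    mono id j (confine _ (λ a∈ b∈ e n → comp-closed a∈ b∈ e (n ∘ i)) x∈ w)

  comp-conn : ∀ {D F u} → Conn (Comp D F u)
  comp-conn x∈ y∈ = comp-confine id (λ ()) x∈ (turn (elim x∈) ▷ elim y∈)

  IEC : Sub → Set
  IEC D = ∀ {x y} → x ∈ D → y ∈ D → ∀ F → Reach D F x y

  -- No vertex of `D` can be cut off from `z` by finitely many edges. The last edge is kept apart
  -- from the walk so that `z` may lie outside `D`.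
  Full : Sub → Vx → Set
  Full D z = ∀ {u} → u ∈ D → ∀ F → ∃ λ v → Reach D F u v × v ~ᴳ z × ¬ EdgeIn v z F

  -- Having infinitely many neighbours in `D`, in the form of escaping every finite list, which
  -- supplies fresh neighbours on demand.
  Thick : Vx → Sub → Set
  Thick x D = ∀ (L : List Vx) → ∃ λ v → v ∈ D × v ~ᴳ x × v ∉ₗ L

  -- When `F` is forbidden along with the new cut, the walk cannot leave the component.
  full-comp : ∀ {D F u z} → Full D z → Full (Comp D F u) z
  full-comp {F = F} full {v} v∈ F′ with full (comp-⊆ v∈) (F ++ F′)
  ... | y , w , e , n = y , comp-confine ⊑-++ˡ (⊑-++ʳ F) v∈ w , e , n ∘ ⊑-++ʳ F

  -- A walk to `w` is stopped just before its first visit to `w`.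
  full-minus : ∀ {E w} → IEC E → w ∈ E → Full (E − w) w
  full-minus iec w∈ u∈ F with first-hit _ (iec (∖-⊆ u∈) w∈ F) (∖-∉ u∈) self
  ... | p , q , r , e , n , q∈ , _ with elim q∈
  ...   | refl = p , r , e , n

  thick-minus : ∀ {x D w} → Thick x D → Thick x (D − w)
  thick-minus {w = w} th L with th (w ∷ L)
  ... | v , v∈ , e , v∉ = v , −-intro v∈ (v∉ ∘ here) , e , v∉ ∘ there

  Cls : Sub → Vx → Sub
  Cls D u = ⟦ (λ v → ∀ F → Reach D F u v) ⟧

  -- Finite edge boundary: all but the finitely many edges in `F` that start in the class stay in
  -- it.
  Atomic : Sub → Vx → Set
  Atomic D u = ∃ λ F → ∀ {x y} → x ∈ Cls D u → y ∈ D → x ~ᴳ y → ¬ EdgeIn x y F →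
    y ∈ Cls D u

  cls-⊆ : ∀ {D u} → Cls D u ⊆ D
  cls-⊆ x∈ = finish (elim x∈ [])

  cls-self : ∀ {D u} → u ∈ D → u ∈ Cls D u
  cls-self u∈ = intro λ _ → stay u∈

  cls-reach : ∀ {D u x y} → x ∈ Cls D u → y ∈ Cls D u → ∀ F → Reach D F x y
  cls-reach x∈ y∈ F = turn (elim x∈ F) ▷ elim y∈ F

  cls-same : ∀ {D u v} → v ∈ Cls D u → Cls D v ⊆ Cls D u
  cls-same v∈ x∈ = intro λ F → elim v∈ F ▷ elim x∈ F

  cls-swap : ∀ {D u v} → v ∈ Cls D u → u ∈ Cls D v
  cls-swap v∈ = intro λ F → turn (elim v∈ F)

  atomic-same : ∀ {D u v} → v ∈ Cls D u → Atomic D u → Atomic D v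
  atomic-same v∈ (F , cl) = F , λ x∈ y∈ e n →
    cls-same (cls-swap v∈) (cl (cls-same v∈ x∈) y∈ e n)

  -- Forbidding the finite boundary as well confines the connecting walks of `D` to the class.
  cls-iec : ∀ {D u} → Atomic D u → IEC (Cls D u)
  cls-iec (F , cl) x∈ y∈ F′ =
    mono id (⊑-++ʳ F)
      (confine _ (λ a∈ b∈ e n → cl a∈ b∈ e (n ∘ ⊑-++ˡ)) x∈ (cls-reach x∈ y∈ (F ++ F′)))

  -- Fullness is applied to the boundary of the class together with all edges from `L` to `z`: the
  -- walk stays in the class and its last edge starts outside `L`.
  cls-thick : ∀ {D u z} → u ∈ D → Full D z → Atomic D u → Thick z (Cls D u)
  cls-thick {z = z} u∈ full (F , cl) L with full u∈ (F ++ star z L)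
  ... | v , w , e , n =
    v , finish (confine _ (λ a∈ b∈ e′ n′ → cl a∈ b∈ e′ (n′ ∘ ⊑-++ˡ)) (cls-self u∈) w) , e
      , n ∘ ⊑-++ʳ F ∘ star-edge

  -- Each piece is a component for a finite cut of its own, so that it inherits fullness from `L`.
  record Scatter (Q L : Sub) : Set where
    field
      cut    : ℕ → Edges
      seed   : ℕ → Vx
      hook   : ℕ → Vx
      seed∈  : ∀ n → seed n ∈ L
      hook∈  : ∀ n → hook n ∈ Q
      link   : ∀ n → hook n ~ᴳ seed n
    piece : ℕ → Sub
    piece n = Comp L (cut n) (seed n)
    field
      apart  : ∀ {m n} → m ≢ n → Disj (piece m) (piece n)
      avoid  : ∀ n → Disj (piece n) Q

  cuts : List (Edges × Vx) → Edges
  cuts = concatMap proj₁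

  cuts-⊑ : ∀ {p ps} → p ∈ₗ ps → proj₁ p ⊑ cuts ps
  cuts-⊑ (here refl)            = ⊑-++ˡ
  cuts-⊑ {ps = q ∷ _} (there i) = ⊑-++ʳ (proj₁ q) ∘ cuts-⊑ i

  -- `P` is the invariant of the pieces: `next` may use it for the pieces made so far in order to
  -- find a seed outside all of them.
  module Scattering (Q L : Sub) (P : Sub → Set)
    (P-anti : ∀ {X Y} → X ⊆ Y → P Y → P X)
    (P-avoid : ∀ {X} → P X → Disj X Q)
    (next : ∀ (ps : List (Edges × Vx)) → All (λ p → P (Comp L (proj₁ p) (proj₂ p))) ps →
      ∃ λ u → ∃ λ h → ∃ λ F → u ∈ L × h ∈ Q × h ~ᴳ u ×
        (∀ {p} → p ∈ₗ ps → u ∉ Comp L (proj₁ p) (proj₂ p)) × P (Comp L F u)) where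

    History : Set
    History = ∃ λ (ps : List (Edges × Vx)) → All (λ p → P (Comp L (proj₁ p) (proj₂ p))) ps

    new : History → Edges × Vx
    new (ps , all) with next ps all
    ... | u , _ , F , _ = F ++ cuts ps , u

    new-P : ∀ H → P (Comp L (proj₁ (new H)) (proj₂ (new H)))
    new-P (ps , all) with next ps all
    ... | u , _ , F , _ , _ , _ , _ , p = P-anti (comp-anti ⊑-++ˡ) p

    history : ℕ → History
    history zero    = [] , []
    history (suc n) = new (history n) ∷ proj₁ (history n) , new-P (history n) ∷ proj₂ (history n)

    earlier : ∀ {m n} → m ℕ.< n → new (history m) ∈ₗ proj₁ (history n)
    earlier {m} {suc n} (ℕ.s≤s m≤n) with ℕₚ.m≤n⇒m<n∨m≡n m≤n
    ... | inj₁ m<n  = there (earlier m<n)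
    ... | inj₂ refl = here refl

    -- A new cut contains all earlier ones, so a common vertex would join the new seed to an earlier
    -- seed within the earlier piece, which `next` excludes.
    fresh : ∀ {F u} H → (F , u) ∈ₗ proj₁ H →
      Disj (Comp L F u) (Comp L (proj₁ (new H)) (proj₂ (new H)))
    fresh (ps , all) i x∈ x∈′ with next ps all
    ... | u , _ , F , _ , _ , _ , far , _ =
      far i (intro (elim x∈ ▷ turn (mono id (⊑-++ʳ F ∘ cuts-⊑ i) (elim x∈′))))

    hook-of : ∀ H → ∃ λ h → proj₂ (new H) ∈ L × h ∈ Q × h ~ᴳ proj₂ (new H)
    hook-of (ps , all) with next ps all
    ... | u , h , _ , u∈ , h∈ , e , _ = h , u∈ , h∈ , e

    scatter : Scatter Q L
    scatter = record
      { cut   = λ n → proj₁ (new (history n))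
      ; seed  = λ n → proj₂ (new (history n))
      ; hook  = λ n → proj₁ (hook-of (history n))
      ; seed∈ = λ n → proj₁ (proj₂ (hook-of (history n)))
      ; hook∈ = λ n → proj₁ (proj₂ (proj₂ (hook-of (history n))))
      ; link  = λ n → proj₂ (proj₂ (proj₂ (hook-of (history n))))
      ; apart = apart
      ; avoid = λ n → P-avoid (new-P (history n))
      }
      where
      apart : ∀ {m n} → m ≢ n → Disj (Comp L (proj₁ (new (history m))) (proj₂ (new (history m))))
                                     (Comp L (proj₁ (new (history n))) (proj₂ (new (history n))))
      apart {m} {n} m≢n x∈ x∈′ with ℕₚ.<-cmp m n
      ... | tri< m<n _ _ = fresh (history n) (earlier m<n) x∈ x∈′
      ... | tri≈ _ eq _  = m≢n eq
      ... | tri> _ _ n<m = fresh (history m) (earlier n<m) x∈′ x∈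

  -- The walks that tie a class together may leave it, so a class need not be connected; the core is
  -- its connected part at `u`.
  Core : Sub → Vx → Sub
  Core L u = Comp (Cls L u) [] u

  core-⊆ : ∀ {L u} → Core L u ⊆ Cls L u
  core-⊆ = comp-⊆

  -- A non-atomic class has infinitely many edges leaving it.  Each of them ends in a vertex
  -- that a finite cut separates from the class.
  nonatomic-scatter : ∀ {L u} → u ∈ L → ¬ Atomic L u → Scatter (Core L u) L
  nonatomic-scatter {L} {u} u∈ na = Scattering.scatter (Core L u) L
      (λ X → Disj X (Core L u)) (λ i d → d ∘ i) id next
    where
    exit : ∀ F → ∃ λ x → ∃ λ y → x ∈ Core L u × y ∈ L × x ~ᴳ y × ¬ EdgeIn x y F × y ∉ Core L u
    -- Otherwise walks from `u` that avoid `F` never leave the core, so the core is the whole class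
    -- and `F` bounds it.
    exit F = dne λ none′ → na (F , λ {x} {y} x∈ y∈ e n →
      let cl : ∀ {a b} → a ∈ Core L u → b ∈ L → a ~ᴳ b → ¬ EdgeIn a b F → b ∈ Core L u
          cl a∈ b∈ e′ n′ = dne λ b∉ → none′ (_ , _ , a∈ , b∈ , e′ , n′ , b∉)
      in core-⊆ (cl (finish (confine _ cl (comp-self (cls-self u∈)) (elim x∈ F))) y∈ e n))

    next : ∀ (ps : List (Edges × Vx)) → All (λ p → Disj (Comp L (proj₁ p) (proj₂ p)) (Core L u)) ps →
      ∃ λ v → ∃ λ h → ∃ λ F → v ∈ L × h ∈ Core L u × h ~ᴳ v ×
        (∀ {p} → p ∈ₗ ps → v ∉ Comp L (proj₁ p) (proj₂ p)) × Disj (Comp L F v) (Core L u)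
    next ps all with exit (cuts ps)
    ... | x , y , x∈ , y∈ , e , n , y∉ = y , x , proj₁ sep , y∈ , x∈ , e , far , disj
      where
      y∉Cls : y ∉ Cls L u
      y∉Cls h = y∉ (comp-closed x∈ h e none)
      sep : ∃ λ F → ¬ Reach L F u y
      sep = ¬∀⇒∃¬ (y∉Cls ∘ intro)
      disj : Disj (Comp L (proj₁ sep) y) (Core L u)
      disj v∈ v∈′ = proj₂ sep (elim (core-⊆ v∈′) _ ▷ turn (elim v∈))
      -- The edge from `x` to `y` avoids all earlier cuts, so an earlier piece containing `y` would
      -- contain the core vertex `x`.
      far : ∀ {p} → p ∈ₗ ps → y ∉ Comp L (proj₁ p) (proj₂ p)
      far i y∈′ = All.lookup all i
        (comp-closed y∈′ (cls-⊆ (core-⊆ x∈)) (~-sym G e) (n ∘ cuts-⊑ i ∘ edge-swap)) x∈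

  Finds : Vx → Sub → Set
  Finds x L = ∃ λ u → u ∈ L × Atomic L u × Thick x (Cls L u)

  -- The counterpart of `Finds`: infinitely many pieces hang off a connected set around `x`. The
  -- field `Q-nonatom` keeps that set away from all atomic classes.
  record Spreads (x : Vx) (L : Sub) : Set where
    field
      Q         : Sub
      Q-conn    : Conn Q
      x∈Q       : x ∈ Q
      Q-⊆       : ∀ {y} → y ∈ Q → y ≡ x ⊎ y ∈ L
      Q-nonatom : ∀ {y} → y ∈ Q → y ∈ L → ¬ Atomic L y
      scat      : Scatter Q L

  Meagre : Vx → Sub → Set
  Meagre x X = ∃ λ (N : List Vx) → ∀ {v} → v ∈ X → v ~ᴳ x → v ∈ₗ N

  ¬thick⇒meagre : ∀ {x X} → ¬ Thick x X → Meagre x X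
  ¬thick⇒meagre nt with ¬∀⇒∃¬ nt
  ... | N , h = N , λ {v} v∈ e → dne λ v∉ → h (v , v∈ , e , v∉)

  -- A neighbour of `x` with a non-atomic class makes that class scatter. If all neighbours have
  -- atomic classes and none of these is thick for `x`, each contains finitely many neighbours of
  -- `x`, so infinitely many classes are met and they serve as pieces off `x` itself.
  finds-or-spreads : ∀ {x L} → x ∉ L → Thick x L → Finds x L ⊎ Spreads x L
  finds-or-spreads {x} {L} x∉ th with em {∃ λ u → u ∈ L × x ~ᴳ u × ¬ Atomic L u}
  ... | yes (u , u∈ , e , na) = inj₂ record
      { Q         = ｛ x ｝ ∪ Core L u
      ; Q-conn    = conn-edge conn-｛｝ comp-conn self (comp-self (cls-self u∈)) e
      ; x∈Q       = ∪ˡ self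
      ; Q-⊆       = ∪-elim (inj₁ ∘ elim) (inj₂ ∘ cls-⊆ ∘ core-⊆)
      ; Q-nonatom = λ y∈ y∈L at → ∪-elim {R = λ y → y ∈ L → Atomic L y → ⊥}
          (λ h y∈L′ _ → x∉ (subst (_∈ L) (elim h) y∈L′))
          (λ h _ at′ → na (atomic-same (cls-swap (core-⊆ h)) at′)) y∈ y∈L at
      ; scat      = record
          { cut = cut ; seed = seed ; hook = hook ; seed∈ = seed∈
          ; hook∈ = ∪ʳ ∘ hook∈ ; link = link ; apart = apart
          ; avoid = λ n y∈ y∈Q → ∪-elim {R = λ y → y ∉ piece n}
              (λ h y∈′ → x∉ (subst (_∈ L) (elim h) (comp-⊆ y∈′))) (λ h y∈′ → avoid n y∈′ h)
              y∈Q y∈ }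
      }
      where open Scatter (nonatomic-scatter u∈ na)
  ... | no allAtomic with em {Finds x L}
  ...   | yes f = inj₁ f
  ...   | no ¬f = inj₂ record
      { Q         = ｛ x ｝
      ; Q-conn    = conn-｛｝
      ; x∈Q       = self
      ; Q-⊆       = inj₁ ∘ elim
      ; Q-nonatom = λ y∈ y∈L _ → x∉ (subst (_∈ L) (elim y∈) y∈L)
      ; scat      = Scattering.scatter ｛ x ｝ L P anti
          (λ (X⊆ , _) y∈ y∈′ → x∉ (subst (_∈ L) (elim y∈′) (X⊆ y∈))) next
      }
      where
      P : Sub → Set
      P X = X ⊆ L × Meagre x X
      anti : ∀ {X Y} → X ⊆ Y → P Y → P X
      anti i (s , N , h) = s ∘ i , N , h ∘ i
      listed : ∀ ps → All (λ p → P (Comp L (proj₁ p) (proj₂ p))) ps →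
        ∃ λ (N : List Vx) → ∀ {v p} → p ∈ₗ ps → v ∈ Comp L (proj₁ p) (proj₂ p) → v ~ᴳ x → v ∈ₗ N
      listed [] [] = [] , λ ()
      listed (p ∷ ps) ((_ , N , h) ∷ all) with listed ps all
      ... | M , k = N ++ M , λ { (here refl) v∈ e → ∈-++⁺ˡ (h v∈ e)
                               ; (there i)   v∈ e → ∈-++⁺ʳ N (k i v∈ e) }
      next : ∀ (ps : List (Edges × Vx)) → All (λ p → P (Comp L (proj₁ p) (proj₂ p))) ps →
        ∃ λ v → ∃ λ h → ∃ λ F → v ∈ L × h ∈ ｛ x ｝ × h ~ᴳ v ×
          (∀ {p} → p ∈ₗ ps → v ∉ Comp L (proj₁ p) (proj₂ p)) × P (Comp L F v)
      next ps all with listed ps all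
      ... | N , h with th N
      ...   | v , v∈ , e , v∉ = v , x , proj₁ at , v∈ , self , ~-sym G e
                              , (λ i v∈′ → v∉ (h i v∈′ e)) , comp-⊆ , anti within meagre .proj₂
        where
        at : Atomic L v
        at = dne λ na → allAtomic (v , v∈ , ~-sym G e , na)
        meagre : P (Cls L v)
        meagre = cls-⊆ , ¬thick⇒meagre λ t → ¬f (v , v∈ , at , t)
        within : Comp L (proj₁ at) v ⊆ Cls L v
        within y∈ = finish (confine _ (proj₂ at) (cls-self v∈) (elim y∈))

-- Nested families of sets indexed by words

-- Words grow at the head, so a strict ancestor is a proper suffix.
data Above {A : Set} (σ : List A) : List A → Set where
  parent : ∀ {k} → Above σ (k ∷ σ)
  later  : ∀ {k τ} → Above σ τ → Above σ (k ∷ τ)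

above-length : ∀ {A : Set} {σ τ : List A} → Above σ τ → length σ ℕ.< length τ
above-length parent    = ℕₚ.n<1+n _
above-length (later a) = ℕₚ.m<n⇒m<1+n (above-length a)

above-[] : ∀ {A : Set} {k : A} {τ} → Above [] (k ∷ τ)
above-[] {τ = []}    = parent
above-[] {τ = _ ∷ _} = later above-[]

module Nested {A X : Set} (_≟_ : (k l : A) → Dec (k ≡ l)) (E : List A → X → Set)
  (nest : ∀ {k σ x} → E (k ∷ σ) x → E σ x)
  (apart : ∀ {k l σ x} → k ≢ l → E (k ∷ σ) x → E (l ∷ σ) x → ⊥) where

  -- By `nest` the words can be shortened in turn until they are siblings, which `apart` forces to
  -- be equal.
  compare : ∀ σ τ {x} → E σ x → E τ x → σ ≡ τ ⊎ Above σ τ ⊎ Above τ σ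
  compare []      []      _ _ = inj₁ refl
  compare []      (_ ∷ _) _ _ = inj₂ (inj₁ above-[])
  compare (_ ∷ _) []      _ _ = inj₂ (inj₂ above-[])
  compare (k ∷ σ) (l ∷ τ) h i with compare (k ∷ σ) τ h (nest i)
  ... | inj₁ refl               = inj₂ (inj₁ parent)
  ... | inj₂ (inj₁ a)           = inj₂ (inj₁ (later a))
  ... | inj₂ (inj₂ parent) with k ≟ l
  ...   | yes refl = inj₁ refl
  ...   | no k≢l   = ⊥-elim (apart k≢l h i)
  compare (k ∷ σ) (l ∷ τ) h i | inj₂ (inj₂ (later a)) with compare σ (l ∷ τ) (nest h) i
  ...   | inj₁ refl               = inj₂ (inj₂ parent)
  ...   | inj₂ (inj₁ parent)      = ⊥-elim (ℕₚ.<-irrefl refl (above-length a))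
  ...   | inj₂ (inj₁ (later b))   = ⊥-elim (ℕₚ.<-asym (above-length a) (above-length b))
  ...   | inj₂ (inj₂ b)           = inj₂ (inj₂ (later b))

  into-child : ∀ {σ τ x} → Above σ τ → E τ x → ∃ λ k → E (k ∷ σ) x
  into-child parent    h = _ , h
  into-child (later a) h = into-child a (nest h)

  -- The points that the children of `σ` leave over. Each point is owned at most once, which yields
  -- the disjointness of branch sets.
  Own : List A → X → Set
  Own σ x = E σ x × (∀ k → ¬ E (k ∷ σ) x)

  own-unique : ∀ {σ τ x} → Own σ x → Own τ x → σ ≡ τ
  own-unique {σ} {τ} (h , o) (i , p) with compare σ τ h i
  ... | inj₁ eq       = eq
  ... | inj₂ (inj₁ a) with into-child a i
  ...   | k , j = ⊥-elim (o k j)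
  own-unique (h , o) (i , p) | inj₂ (inj₂ a) with into-child a h
  ...   | k , j = ⊥-elim (p k j)

  to-root : ∀ σ {x} → E σ x → E [] x
  to-root []      h = h
  to-root (_ ∷ σ) h = to-root σ (nest h)

-- Growing T-ℵ₀*t step by step

module TreeMinor (em : ExcludedMiddle 0ℓ) (G : Graph) where
  open Sets em G

  relax : ∀ {D F} {S : Vx → Set} → (∀ {x} → x ∈ D → S x) →
    ∀ {x y} → Reach D F x y → Walk G S (λ _ _ → ⊤) x y
  relax i (stay h)       = stay (i h)
  relax i (step h e _ w) = step (i h) e tt (relax i w)

  back : ∀ {S : Vx → Set} {x y} → Walk G S (λ _ _ → ⊤) x y → Walk G S (λ _ _ → ⊤) y x
  back = reverse id

  -- A place where a subtree can still be grown: it enters at `seed`, and `root` is a vertex of the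
  -- apex side.
  record State : Set where
    field
      dom   : Sub
      root  : Vx
      seed  : Vx
      seed∈ : seed ∈ dom
      root∉ : root ∉ dom
      full  : Full dom root
      conn  : Conn dom

  open State

  -- One step in growing T-ℵ₀*t: c becomes a node, q is added to the apex, and the subtrees below
  -- c are to be grown in the children.
  record TStep (s : State) : Set where
    field
      c q         : Sub
      seed∈c      : seed s ∈ c
      c-conn      : Conn c
      c-⊆         : c ⊆ dom s
      root∈q      : root s ∈ q
      q-conn      : Conn q
      q-⊆         : ∀ {x} → x ∈ q → x ≡ root s ⊎ x ∈ dom s
      c-q         : Disj c q
      child       : ℕ → State
      child-⊆     : ∀ n → dom (child n) ⊆ dom s
      child-c     : ∀ n → Disj (dom (child n)) c
      child-q     : ∀ n → Disj (dom (child n)) q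
      child-root  : ∀ n → root (child n) ∈ q
      child-link  : ∀ n → ∃ λ h → h ∈ c × h ~ᴳ seed (child n)
      child-apart : ∀ {m n} → m ≢ n → Disj (dom (child m)) (dom (child n))

  -- The invariant `𝒮` guarantees a further step. It is used with atomlessness, and with `⊤` when
  -- every state admits a step.
  module Grow (𝒮 : State → Set)
    (next : ∀ s → 𝒮 s → Σ (TStep s) λ t → ∀ n → 𝒮 (TStep.child t n))
    (s₀ : State) (𝒮₀ : 𝒮 s₀) where

    open TStep

    states : List ℕ → Σ State 𝒮
    states []      = s₀ , 𝒮₀
    states (k ∷ σ) with next (proj₁ (states σ)) (proj₂ (states σ))
    ... | t , hs = child t (suc k) , hs (suc k)

    at : List ℕ → State
    at = proj₁ ∘ states

    tstep : ∀ σ → TStep (at σ)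
    tstep σ = proj₁ (next (at σ) (proj₂ (states σ)))

    E : List ℕ → Vx → Set
    E σ x = x ∈ dom (at σ)

    -- Child 0 is used up to make every node adjacent to the apex.
    spare node : List ℕ → Sub
    spare σ = dom (child (tstep σ) 0)
    node σ = c (tstep σ) ∪ spare σ

    open Nested ℕ._≟_ E
      (λ {k} {σ} → child-⊆ (tstep σ) (suc k))
      (λ {_} {_} {σ} k≢l → child-apart (tstep σ) (k≢l ∘ ℕₚ.suc-injective))

    node-⊆ : ∀ σ → node σ ⊆ dom (at σ)
    node-⊆ σ = ∪-elim (c-⊆ (tstep σ)) (child-⊆ (tstep σ) 0)

    node-own : ∀ σ {x} → x ∈ node σ → Own σ x
    node-own σ x∈ = node-⊆ σ x∈ , λ k h → ∪-elim {R = λ y → ¬ E (k ∷ σ) y}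
      (λ y∈ i → child-c (tstep σ) (suc k) i y∈)
      (λ y∈ i → child-apart (tstep σ) (λ ()) y∈ i) x∈ h

    node-q : ∀ σ → Disj (node σ) (q (tstep σ))
    node-q σ x∈ x∈q = ∪-elim {R = λ y → y ∉ q (tstep σ)}
      (c-q (tstep σ)) (child-q (tstep σ) 0) x∈ x∈q

    -- A set `q` may contain the root of its state, which lies outside the domain. The clause
    -- `E σ x` keeps the vertices inside the domain, which are then owned by `σ`.
    branch : Maybe (List ℕ) → Vx → Set
    branch (just σ) x = x ∈ node σ
    branch nothing  x = x ≡ root s₀ ⊎ ∃ λ σ → x ∈ q (tstep σ) × E σ x

    apart′ : ∀ σ {x} → x ∈ node σ → ¬ branch nothing x
    apart′ σ x∈ (inj₁ refl) = root∉ s₀ (to-root σ (node-⊆ σ x∈))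
    apart′ σ x∈ (inj₂ (τ , x∈q , h))
      with own-unique {σ} {τ} (node-own σ x∈) (h , λ k i → child-q (tstep τ) (suc k) i x∈q)
    ... | refl = node-q σ x∈ x∈q

    disj : ∀ {h h′ x} → branch h x → branch h′ x → h ≡ h′
    disj {just σ}  {just τ}  x∈ x∈′ = cong just (own-unique (node-own σ x∈) (node-own τ x∈′))
    disj {just σ}  {nothing} x∈ x∈′ = ⊥-elim (apart′ σ x∈ x∈′)
    disj {nothing} {just σ}  x∈ x∈′ = ⊥-elim (apart′ σ x∈′ x∈)
    disj {nothing} {nothing} _  _   = refl

    q-branch : ∀ σ {x} → x ∈ q (tstep σ) → branch nothing x
    q-branch σ x∈ with q-⊆ (tstep σ) x∈
    ... | inj₂ h = inj₂ (σ , x∈ , h)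
    q-branch []      x∈ | inj₁ refl = inj₁ refl
    q-branch (k ∷ σ) x∈ | inj₁ refl = q-branch σ (child-root (tstep σ) (suc k))

    q-walk : ∀ σ {x} → x ∈ q (tstep σ) → Walk G (branch nothing) (λ _ _ → ⊤) x (root s₀)
    q-walk σ x∈ = relax (q-branch σ) (q-conn (tstep σ) x∈ (root∈q (tstep σ))) ▷ up′ σ
      where
      up′ : ∀ σ → Walk G (branch nothing) (λ _ _ → ⊤) (root (at σ)) (root s₀)
      up′ []      = stay (inj₁ refl)
      up′ (k ∷ σ) = q-walk σ (child-root (tstep σ) (suc k))

    apex-walk : ∀ {x} → branch nothing x → Walk G (branch nothing) (λ _ _ → ⊤) x (root s₀)
    apex-walk (inj₁ refl)          = stay (inj₁ refl)
    apex-walk (inj₂ (σ , x∈q , _)) = q-walk σ x∈q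

    node-conn : ∀ σ → Conn (node σ)
    node-conn σ with child-link (tstep σ) 0
    ... | h , h∈ , e = conn-edge (c-conn (tstep σ)) (conn (child (tstep σ) 0)) h∈
                         (seed∈ (child (tstep σ) 0)) e

    tree-edge : ∀ k σ → ∃ λ x → ∃ λ y → x ∈ node σ × y ∈ node (k ∷ σ) × x ~ᴳ y
    tree-edge k σ with child-link (tstep σ) (suc k)
    ... | h , h∈ , e = h , _ , ∪ˡ h∈ , ∪ˡ (seed∈c (tstep (k ∷ σ))) , e

    apex-edge : ∀ σ → ∃ λ x → ∃ λ y → branch nothing x × y ∈ node σ × x ~ᴳ y
    -- Fullness of the spare child gives an edge to its root, which lies in `q`.
    apex-edge σ with full (child (tstep σ) 0) (seed∈ (child (tstep σ) 0)) []
    ... | v , w , e , _ = _ , v , q-branch σ (child-root (tstep σ) 0) , ∪ʳ (finish w) , ~-sym G e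

    minor : T-ℵ₀*t ≼ G
    minor = record
      { branch    = branch
      ; disjoint  = λ {h} {h′} → disj {h} {h′}
      ; nonempty  = λ { (just σ) → _ , ∪ˡ (seed∈c (tstep σ)) ; nothing → root s₀ , inj₁ refl }
      ; connected = λ { (just σ) x∈ y∈ → relax id (node-conn σ x∈ y∈)
                      ; nothing x∈ y∈ → apex-walk x∈ ▷ back (apex-walk y∈) }
      ; edges     = edges
      }
      where
      flip-edge : ∀ {P Q : Vx → Set} → (∃ λ x → ∃ λ y → P x × Q y × x ~ᴳ y) →
        ∃ λ x → ∃ λ y → Q x × P y × x ~ᴳ y
      flip-edge (x , y , p , r , e) = y , x , r , p , ~-sym G e
      edges : ∀ {h h′} → TtAdj h h′ → ∃ λ x → ∃ λ y → branch h x × branch h′ y × x ~ᴳ y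
      edges (tree (down n x)) = tree-edge n x
      edges (tree (up n x))   = flip-edge (tree-edge n x)
      edges (apexˡ x)         = apex-edge x
      edges (apexʳ x)         = flip-edge (apex-edge x)

-- Sets without atomic classes

module Atoms (em : ExcludedMiddle 0ℓ) (G : Graph) where
  open Sets em G
  open TreeMinor em G
  open State

  piece-state : ∀ {Q L z} → (S : Scatter Q L) → z ∉ L → Full L z → ℕ → State
  piece-state {z = z} S z∉ full n = record
    { dom   = Scatter.piece S n
    ; root  = z
    ; seed  = Scatter.seed S n
    ; seed∈ = comp-self (Scatter.seed∈ S n)
    ; root∉ = z∉ ∘ comp-⊆
    ; full  = full-comp full
    ; conn  = comp-conn
    }

  -- Since `F` may be added to any cut, the class of `y` is the same in the component and in `L`;
  -- its boundary grows by edges of `F` only.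
  comp-atomic : ∀ {L F u y} → y ∈ Comp L F u → Atomic (Comp L F u) y → Atomic L y
  comp-atomic {L} {F} {u} {y} y∈ (F′ , cl) = F ++ F′ , λ x∈ b∈ e n →
    let x∈′ = intro λ F″ → comp-confine ⊑-++ˡ (⊑-++ʳ F) y∈ (elim x∈ (F ++ F″))
    in intro λ F″ → mono comp-⊆ id
         (elim (cl x∈′ (comp-closed (cls-⊆ x∈′) b∈ e (n ∘ ⊑-++ˡ)) e (n ∘ ⊑-++ʳ F)) F″)

  Atomless : Sub → Set
  Atomless D = ∀ {v} → v ∈ D → ¬ Atomic D v

  atomless-comp : ∀ {D F u} → Atomless D → Atomless (Comp D F u)
  atomless-comp al v∈ at = al (comp-⊆ v∈) (comp-atomic v∈ at)

  -- The core is the new node, the pieces around it are the children, and the apex side is the root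
  -- alone.
  scatter-step : ∀ s → ¬ Atomic (dom s) (seed s) → TStep s
  scatter-step s na = record
    { c           = Core (dom s) (seed s)
    ; q           = ｛ root s ｝
    ; seed∈c      = comp-self (cls-self (seed∈ s))
    ; c-conn      = comp-conn
    ; c-⊆         = cls-⊆ ∘ core-⊆
    ; root∈q      = self
    ; q-conn      = conn-｛｝
    ; q-⊆         = inj₁ ∘ elim
    ; c-q         = λ x∈ x∈q → at-root (cls-⊆ (core-⊆ x∈)) x∈q
    ; child       = piece-state S (root∉ s) (full s)
    ; child-⊆     = λ _ → comp-⊆
    ; child-c     = avoid
    ; child-q     = λ n x∈ → at-root (comp-⊆ x∈)
    ; child-root  = λ _ → self
    ; child-link  = λ n → hook n , hook∈ n , link n
    ; child-apart = apart
    }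
    where
    S : Scatter (Core (dom s) (seed s)) (dom s)
    S = nonatomic-scatter (seed∈ s) na
    open Scatter S
    at-root : ∀ {x} → x ∈ dom s → x ∉ ｛ root s ｝
    at-root x∈ x∈q = root∉ s (subst (_∈ dom s) (elim x∈q) x∈)

  atomless-minor : ∀ {D z u} → z ∉ D → Full D z → u ∈ D → Atomless D → T-ℵ₀*t ≼ G
  atomless-minor {D} {z} {u} z∉ full u∈ al = Grow.minor (Atomless ∘ dom)
    (λ s al′ → scatter-step s (al′ (seed∈ s)) , λ _ → atomless-comp al′)
    (record { dom = Comp D [] u ; root = z ; seed = u ; seed∈ = comp-self u∈
            ; root∉ = z∉ ∘ comp-⊆ ; full = full-comp full ; conn = comp-conn })
    (atomless-comp al)

  -- What remains when `atomless-minor` never applies.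
  HasAtoms : Set
  HasAtoms = ∀ {D z u} → z ∉ D → Full D z → u ∈ D → ∃ λ v → v ∈ D × Atomic D v

-- Zones at a stuck state and their splitting

module Zones (em : ExcludedMiddle 0ℓ) (G : Graph)
  (s₀ : TreeMinor.State em G) (stuck : ¬ TreeMinor.TStep em G s₀)
  (atoms : Atoms.HasAtoms em G) where
  open Sets em G
  open TreeMinor em G
  open Atoms em G

  D₀ : Sub
  D₀ = State.dom s₀

  z₀ u₀ : Vx
  z₀ = State.root s₀
  u₀ = State.seed s₀

  -- A is a connected extension of the root side and B one of the seed side; E is unused space.
  record Cfg (A B E : Sub) : Set where
    field
      A-conn : Conn A
      B-conn : Conn B
      A-B    : Disj A B
      z₀∈A   : z₀ ∈ A
      u₀∈B   : u₀ ∈ B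
      A-⊆    : ∀ {x} → x ∈ A → x ≡ z₀ ⊎ x ∈ D₀
      B-⊆    : B ⊆ D₀
      E-⊆    : E ⊆ D₀
      E-A    : Disj E A
      E-B    : Disj E B

  shrink : ∀ {A B E E′} → Cfg A B E → E′ ⊆ E → Cfg A B E′
  shrink cfg i = record
    { A-conn = A-conn ; B-conn = B-conn ; A-B = A-B ; z₀∈A = z₀∈A ; u₀∈B = u₀∈B
    ; A-⊆ = A-⊆ ; B-⊆ = B-⊆ ; E-⊆ = E-⊆ ∘ i ; E-A = E-A ∘ i ; E-B = E-B ∘ i }
    where open Cfg cfg

  grow-A : ∀ {A B E R} → Cfg A B E → Conn (A ∪ R) →
    (∀ {x} → x ∈ R → x ∈ A ⊎ (x ∈ D₀ × x ∉ B)) → Disj E R → Cfg (A ∪ R) B E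
  grow-A {A} {B} {E} {R} cfg cn i d = record
    { A-conn = cn
    ; B-conn = B-conn
    ; A-B    = ∪-elim {R = _∉ B} A-B (λ h → [ A-B , proj₂ ]′ (i h))
    ; z₀∈A   = ∪ˡ z₀∈A
    ; u₀∈B   = u₀∈B
    ; A-⊆    = ∪-elim A-⊆ (λ h → [ A-⊆ , inj₂ ∘ proj₁ ]′ (i h))
    ; B-⊆    = B-⊆
    ; E-⊆    = E-⊆
    ; E-A    = λ x∈E → [ E-A x∈E , d x∈E ]′ ∘ elim
    ; E-B    = E-B
    }
    where open Cfg cfg

  grow-B : ∀ {A B E E′ R} → Cfg A B E → Conn (B ∪ R) → R ⊆ E → E′ ⊆ E → Disj E′ R →
    Cfg A (B ∪ R) E′
  grow-B {A} {B} {E} {E′} {R} cfg cn i j d = record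
    { A-conn = A-conn
    ; B-conn = cn
    ; A-B    = λ x∈A → [ A-B x∈A , (λ x∈R → E-A (i x∈R) x∈A) ]′ ∘ elim
    ; z₀∈A   = z₀∈A
    ; u₀∈B   = ∪ˡ u₀∈B
    ; A-⊆    = A-⊆
    ; B-⊆    = ∪-elim B-⊆ (E-⊆ ∘ i)
    ; E-⊆    = E-⊆ ∘ j
    ; E-A    = E-A ∘ j
    ; E-B    = λ x∈E → [ E-B (j x∈E) , d x∈E ]′ ∘ elim
    }
    where open Cfg cfg

  -- Were b spread over E, the pieces would be the children of a step at s₀ (each of them
  -- rooted at w), with node B ∪ Q and apex part A.
  finds : ∀ {A B E w b} → Cfg A B E → w ∈ A → Full E w → b ∈ B → Thick b E → Finds b E
  finds {A} {B} {E} {w} {b} cfg w∈ full b∈ th =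
      [ id , (λ sp → ⊥-elim (stuck (tstep sp))) ]′ (finds-or-spreads (λ h → E-B h b∈) th)
    where
    open Cfg cfg
    tstep : Spreads b E → TStep s₀
    tstep sp = record
      { c           = B ∪ Q
      ; q           = A
      ; seed∈c      = ∪ˡ u₀∈B
      ; c-conn      = conn-meet B-conn Q-conn b∈ x∈Q
      ; c-⊆         = ∪-elim B-⊆ λ h → [ (λ { refl → B-⊆ b∈ }) , E-⊆ ]′ (Q-⊆ h)
      ; root∈q      = z₀∈A
      ; q-conn      = A-conn
      ; q-⊆         = A-⊆
      ; c-q         = ∪-elim {R = _∉ A} (λ h h′ → A-B h′ h)
                        (λ h → [ (λ { refl h′ → A-B h′ b∈ }) , E-A ]′ (Q-⊆ h))
      ; child       = piece-state scat (λ h → E-A h w∈) full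
      ; child-⊆     = λ n → E-⊆ ∘ comp-⊆
      ; child-c     = λ n x∈ → [ E-B (comp-⊆ x∈) , Scatter.avoid scat n x∈ ]′ ∘ elim
      ; child-q     = λ n → E-A ∘ comp-⊆
      ; child-root  = λ _ → w∈
      ; child-link  = λ n → Scatter.hook scat n , ∪ʳ (Scatter.hook∈ scat n) , Scatter.link scat n
      ; child-apart = Scatter.apart scat
      }
      where open Spreads sp

  -- `X` is the part of `A` that counts as the left end, while the right end is the single vertex
  -- `b`; both ends have infinitely many neighbours in `E`.
  record Zone (A B E X : Sub) (b : Vx) : Set where
    field
      cfg     : Cfg A B E
      iec     : IEC E
      X-⊆     : X ⊆ A
      X-conn  : Conn X
      a       : Vx
      a∈      : a ∈ X
      a-thick : Thick a E
      b∈      : b ∈ B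
      b-thick : Thick b E

  Zone₁ : Sub → Vx → Vx → Set
  Zone₁ E a b = ∃ λ A → ∃ λ B → Zone A B E ｛ a ｝ b

  zone₁ : ∀ {A B E a b} → Cfg A B E → IEC E → a ∈ A → Thick a E → b ∈ B → Thick b E →
    Zone₁ E a b
  zone₁ {A} {B} cfg iec a∈ ta b∈ tb = A , B , record
    { cfg = cfg ; iec = iec ; X-⊆ = ｛｝-⊆ a∈ ; X-conn = conn-｛｝ ; a = _ ; a∈ = self
    ; a-thick = ta ; b∈ = b∈ ; b-thick = tb }

  record Thickened (E : Sub) (y b : Vx) : Set where
    field
      R C    : Sub
      a      : Vx
      R-conn : Conn R
      y∈R    : y ∈ R
      R-⊆    : R ⊆ E
      a∈R    : a ∈ R
      C-⊆    : C ⊆ E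
      C-R    : Disj C R
      zone   : Zone₁ C a b

  -- An atomic class `K` of `E` is thick for `b`. From `y` it is reached through a connected set `R`
  -- that meets it in one vertex `a`. In `K − a` the vertex `b` finds a class, and fullness makes
  -- `a` thick for the same class.
  thicken : ∀ {A B E b h y} → Cfg A B E → Conn E → Full E b → b ∈ B → h ∈ A → y ∈ E → h ~ᴳ y →
    Thickened E y b
  thicken {A} {B} {E} {b} {h} {y} cfg conn full b∈ h∈ y∈ e
    with atoms (λ i → Cfg.E-B cfg i b∈) full y∈
  ... | v , v∈ , at = conclude approach
    where
    open Cfg cfg
    K : Sub
    K = Cls E v
    Approach : Set
    Approach = ∃ λ R → ∃ λ a → Conn R × y ∈ R × R ⊆ E × a ∈ R × a ∈ K ×
      (∀ {x} → x ∈ R → x ∈ K → x ≡ a)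
    approach : Approach
    approach with em {y ∈ K}
    ... | yes y∈K = ｛ y ｝ , y , conn-｛｝ , self , ｛｝-⊆ y∈ , self , y∈K , λ i _ → elim i
    ... | no  y∉K with first-hit K (conn y∈ v∈) y∉K (cls-self v∈)
    ...   | p , q , r , pq , _ , q∈ , _ =
      Comp (E ∖ K) [] y ∪ ｛ q ｝ , q
      , conn-edge comp-conn conn-｛｝ (intro r) self pq
      , ∪ˡ (comp-self (start r)) , ∪-elim (∖-⊆ ∘ comp-⊆) (｛｝-⊆ (cls-⊆ q∈)) , ∪ʳ self , q∈
      , ∪-elim (λ i j → ⊥-elim (∖-∉ (comp-⊆ i) j)) (λ i _ → elim i)
    conclude : Approach → Thickened E y b
    conclude (R , a , R-conn , y∈R , R-⊆ , a∈R , a∈K , only)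
      with finds cfg′ (∪ʳ a∈R) full-a b∈ (thick-minus (cls-thick v∈ full at))
      where
      full-a : Full (K − a) a
      full-a = full-minus (cls-iec at) a∈K
      cfg′ : Cfg (A ∪ R) B (K − a)
      cfg′ = grow-A (shrink cfg (cls-⊆ ∘ ∖-⊆)) (conn-edge A-conn R-conn h∈ y∈R e)
        (λ i → inj₂ (E-⊆ (R-⊆ i) , E-B (R-⊆ i))) (λ i j → −-≢ i (only j (∖-⊆ i)))
    ... | u , u∈ , at′ , tb = record
      { R = R ; C = Cls (K − a) u ; a = a ; R-conn = R-conn ; y∈R = y∈R ; R-⊆ = R-⊆ ; a∈R = a∈R
      ; C-⊆  = cls-⊆ ∘ ∖-⊆ ∘ cls-⊆
      ; C-R  = λ i j → −-≢ (cls-⊆ i) (only j (∖-⊆ (cls-⊆ i)))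
      ; zone = zone₁
          (grow-A (shrink cfg (cls-⊆ ∘ ∖-⊆ ∘ cls-⊆)) (conn-edge A-conn R-conn h∈ y∈R e)
            (λ i → inj₂ (E-⊆ (R-⊆ i) , E-B (R-⊆ i)))
            (λ i j → −-≢ (cls-⊆ i) (only j (∖-⊆ (cls-⊆ i)))))
          (cls-iec at′) (∪ʳ a∈R)
          (cls-thick u∈ (full-minus (cls-iec at) a∈K) at′) b∈ tb
      }

  -- X′ enlarges the branch set of the left end; w starts the branch set of a new point between
  -- the two ends.
  record Split (C X : Sub) (b : Vx) : Set where
    field
      X′ E₁ E₂ : Sub
      a w      : Vx
      X-⊆      : X ⊆ X′
      X′-⊆     : ∀ {x} → x ∈ X′ → x ∈ X ⊎ x ∈ C
      X′-conn  : Conn X′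
      a∈       : a ∈ X′
      w∈       : w ∈ C
      w∉X′     : w ∉ X′
      E₁-⊆     : E₁ ⊆ C
      E₂-⊆     : E₂ ⊆ C
      E₁-X′    : Disj E₁ X′
      E₂-X′    : Disj E₂ X′
      w∉E₁     : w ∉ E₁
      w∉E₂     : w ∉ E₂
      E₁-E₂    : Disj E₁ E₂
      left     : Zone₁ E₁ a w
      right    : Zone₁ E₂ w b

  split-weaken : ∀ {C X E X₀ b} → C ⊆ E → X₀ ⊆ X → (∀ {x} → x ∈ X → x ∈ X₀ ⊎ x ∈ E) →
    Split C X b → Split E X₀ b
  split-weaken i j k s = record
    { X′ = X′ ; E₁ = E₁ ; E₂ = E₂ ; a = a ; w = w
    ; X-⊆ = X-⊆ ∘ j ; X′-⊆ = λ h → [ k , inj₂ ∘ i ]′ (X′-⊆ h)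
    ; X′-conn = X′-conn ; a∈ = a∈ ; w∈ = i w∈ ; w∉X′ = w∉X′
    ; E₁-⊆ = i ∘ E₁-⊆ ; E₂-⊆ = i ∘ E₂-⊆ ; E₁-X′ = E₁-X′ ; E₂-X′ = E₂-X′
    ; w∉E₁ = w∉E₁ ; w∉E₂ = w∉E₂ ; E₁-E₂ = E₁-E₂ ; left = left ; right = right }
    where open Split s

  -- After the deletion of `v`, both `b` and `v` are thick for the class `C′`. Either `v` joins the
  -- left end, as in `zone′`, or it becomes a new point between the ends, as in `right′`.
  module Delete {A B C X b v h} (Z : Zone A B C X b) (v∈ : v ∈ C) (h∈ : h ∈ X) (e : h ~ᴳ v) where
    open Zone Z
    open Cfg cfg

    L : Sub
    L = C − v

    full-v : Full L v
    full-v = full-minus iec v∈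

    A′-conn : Conn (A ∪ ｛ v ｝)
    A′-conn = conn-edge A-conn conn-｛｝ (X-⊆ h∈) self e

    cfg-L : Cfg (A ∪ ｛ v ｝) B L
    cfg-L = grow-A (shrink cfg ∖-⊆) A′-conn
      (λ i → inj₂ (E-⊆ (｛｝-⊆ v∈ i) , E-B (｛｝-⊆ v∈ i))) (λ i j → ∖-∉ i j)

    abstract
      found : Finds b L
      found = finds cfg-L (∪ʳ self) full-v b∈ (thick-minus b-thick)

    u : Vx
    u = proj₁ found

    at : Atomic L u
    at = proj₁ (proj₂ (proj₂ found))

    C′ : Sub
    C′ = Cls L u

    C′-⊆ : C′ ⊆ L
    C′-⊆ = cls-⊆

    v∉C′ : v ∉ C′
    v∉C′ i = −-≢ (C′-⊆ i) refl

    C′-iec : IEC C′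
    C′-iec = cls-iec at

    v-thick : Thick v C′
    v-thick = cls-thick (proj₁ (proj₂ found)) full-v at

    b-thick′ : Thick b C′
    b-thick′ = proj₂ (proj₂ (proj₂ found))

    zone′ : Zone (A ∪ ｛ v ｝) B C′ (X ∪ ｛ v ｝) b
    zone′ = record
      { cfg     = shrink cfg-L C′-⊆
      ; iec     = C′-iec
      ; X-⊆     = ∪-elim (∪ˡ ∘ X-⊆) ∪ʳ
      ; X-conn  = conn-edge X-conn conn-｛｝ h∈ self e
      ; a       = v
      ; a∈      = ∪ʳ self
      ; a-thick = v-thick
      ; b∈      = b∈
      ; b-thick = b-thick′
      }

    right′ : Zone₁ C′ v b
    right′ = zone₁ (shrink cfg-L C′-⊆) C′-iec (∪ʳ self) v-thick b∈ b-thick′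

    -- For a left half that ends in `v`, the vertex `v` has to lie on the `B` side; it is tied to
    -- `b` through `C′`.
    M : Sub
    M = ｛ v ｝ ∪ C′

    v∈M : v ∈ M
    v∈M = ∪ˡ self

    M-⊆ : M ⊆ C
    M-⊆ = ∪-elim (｛｝-⊆ v∈) (∖-⊆ ∘ C′-⊆)

    M-conn : Conn M
    M-conn = let y , y∈ , yv , _ = v-thick [] in
      conn-edge conn-｛｝ (λ i j → C′-iec i j []) self y∈ (~-sym G yv)

    B∪M-conn : Conn (B ∪ M)
    B∪M-conn = let y , y∈ , yb , _ = b-thick′ [] in
      conn-edge B-conn M-conn b∈ (∪ʳ y∈) (~-sym G yb)

    off-M : ∀ {x} → x ∈ L → x ∉ C′ → x ∉ M
    off-M x∈ x∉ = x∉ ∘ [ (λ j → ⊥-elim (∖-∉ x∈ j)) , id ]′ ∘ elim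

    cfg-M : ∀ {E′} → E′ ⊆ L → Disj E′ C′ → Cfg A (B ∪ M) E′
    cfg-M i d = grow-B cfg B∪M-conn M-⊆ (∖-⊆ ∘ i) (λ x∈ → off-M (i x∈) (d x∈))

    module At {s} (s∈ : s ∈ X) (s-thick : Thick s C) where

      s∉L : s ∉ L
      s∉L i = E-A (∖-⊆ i) (X-⊆ s∈)

      -- Classes coincide or are disjoint. A class other than `C′` is thick for `s` and, by
      -- fullness, for `v`: it is the left half.
      from-find : Finds s L → Split C X b ⊎ Thick s C′
      from-find (t , t∈ , at′ , th) with em {t ∈ C′}
      ... | yes t∈C′ = inj₂ λ N → let y , y∈ , rest = th N in y , cls-same t∈C′ y∈ , rest
      ... | no  t∉C′ = inj₁ record
        { X′ = X ; E₁ = Cls L t ; E₂ = C′ ; a = s ; w = v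
        ; X-⊆ = id ; X′-⊆ = inj₁ ; X′-conn = X-conn ; a∈ = s∈ ; w∈ = v∈
        ; w∉X′ = λ i → E-A v∈ (X-⊆ i)
        ; E₁-⊆ = ∖-⊆ ∘ cls-⊆ ; E₂-⊆ = ∖-⊆ ∘ C′-⊆
        ; E₁-X′ = λ i j → E-A (∖-⊆ (cls-⊆ i)) (X-⊆ j)
        ; E₂-X′ = λ i j → E-A (∖-⊆ (C′-⊆ i)) (X-⊆ j)
        ; w∉E₁ = λ i → −-≢ (cls-⊆ i) refl ; w∉E₂ = v∉C′ ; E₁-E₂ = sep
        ; left = zone₁ (cfg-M cls-⊆ sep) (cls-iec at′) (X-⊆ s∈) th (∪ʳ v∈M)
                   (cls-thick t∈ full-v at′)
        ; right = right′ }
        where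
        sep : Disj (Cls L t) C′
        sep i j = t∉C′ (cls-same j (cls-swap i))

      -- Some piece misses `C′`. Thickening it from its hook gives the left half, and `Q` together
      -- with the connecting set `R` joins the left end.
      from-spread : Spreads s L → Split C X b
      from-spread sp = from-free (free)
        where
        open Spreads sp
        open Scatter scat

        -- Vertices of `C′` have an atomic class, those of `Q` in `L` do not.
        Q-C′ : Disj Q C′
        Q-C′ i j = Q-nonatom i (C′-⊆ j) (atomic-same j at)

        -- No finite cut divides `C′`, so a piece that meets it swallows it and piece 1 is disjoint
        -- from piece 0.
        free : ∃ λ n → Disj (piece n) C′
        free with em {∃ λ x → x ∈ piece 0 × x ∈ C′}
        ... | no  none′ = 0 , λ i j → none′ (_ , i , j)
        ... | yes (x , i , j) = 1 , λ i′ j′ →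
          apart {0} {1} (λ ()) (intro (elim i ▷ cls-reach j j′ (cut 0))) i′

        from-free : (∃ λ n → Disj (piece n) C′) → Split C X b
        from-free (n , d) = record
          { X′ = (X ∪ Q) ∪ R ; E₁ = T.C ; E₂ = C′ ; a = T.a ; w = v
          ; X-⊆ = ∪ˡ ∘ ∪ˡ
          ; X′-⊆ = ∪-elim (∪-elim inj₁ (λ i → [ (λ { refl → inj₁ s∈ }) , inj₂ ∘ ∖-⊆ ]′ (Q-⊆ i)))
                          (inj₂ ∘ ∖-⊆ ∘ R⊆L)
          ; X′-conn = conn-edge (conn-meet X-conn Q-conn s∈ x∈Q) T.R-conn (∪ʳ (hook∈ n)) T.y∈R
                        (link n)
          ; a∈ = ∪ʳ T.a∈R ; w∈ = v∈
          ; w∉X′ = λ i → off-X′ v∈ (λ j → Q∌v j) (λ j → −-≢ (R⊆L j) refl) i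
          ; E₁-⊆ = ∖-⊆ ∘ C⊆L ; E₂-⊆ = ∖-⊆ ∘ C′-⊆
          ; E₁-X′ = λ i → off-X′ (∖-⊆ (C⊆L i)) (avoid n (T.C-⊆ i)) (T.C-R i)
          ; E₂-X′ = λ i → off-X′ (∖-⊆ (C′-⊆ i)) (λ j → Q-C′ j i) (λ j → d (T.R-⊆ j) i)
          ; w∉E₁ = λ i → −-≢ (C⊆L i) refl ; w∉E₂ = v∉C′
          ; E₁-E₂ = λ i j → d (T.C-⊆ i) j
          ; left = T.zone
          ; right = right′ }
          where
          Q∌v : v ∉ Q
          Q∌v i = [ (λ { refl → E-A v∈ (X-⊆ s∈) }) , (λ j → −-≢ j refl) ]′ (Q-⊆ i)
          cfg-Q : Cfg (A ∪ Q) (B ∪ M) (piece n)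
          cfg-Q = grow-A (cfg-M comp-⊆ d) (conn-meet A-conn Q-conn (X-⊆ s∈) x∈Q)
            (λ {x} i → [ (λ { refl → inj₁ (X-⊆ s∈) })
                       , (λ j → inj₂ (E-⊆ (∖-⊆ j)
                               , [ E-B (∖-⊆ j) , off-M j (Q-C′ i) ]′ ∘ elim)) ]′ (Q-⊆ i))
            (avoid n)
          module T = Thickened (thicken cfg-Q comp-conn (full-comp full-v) (∪ʳ v∈M)
                                 (∪ʳ (hook∈ n)) (comp-self (seed∈ n)) (link n))
          open T using (R)
          R⊆L : T.R ⊆ L
          R⊆L = comp-⊆ ∘ T.R-⊆
          C⊆L : T.C ⊆ L
          C⊆L = comp-⊆ ∘ T.C-⊆
          off-X′ : ∀ {x} → x ∈ C → x ∉ Q → x ∉ T.R → x ∉ (X ∪ Q) ∪ T.R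
          off-X′ x∈ x∉Q x∉R i =
            [ (λ j → [ (λ k → E-A x∈ (X-⊆ k)) , x∉Q ]′ (elim j)) , x∉R ]′ (elim i)

      split-or-thick : Split C X b ⊎ Thick s C′
      split-or-thick = [ from-find , inj₁ ∘ from-spread ]′
        (finds-or-spreads s∉L (thick-minus s-thick))

-- Numbering the nodes of the tree

-- Cantor's enumeration: it runs along the diagonals of constant sum, and the diagonal of sum `k`
-- starts at `triangle k`.
next-pair : ℕ × ℕ → ℕ × ℕ
next-pair (i , zero)  = 0 , suc i
next-pair (i , suc j) = suc i , j

pair : ℕ → ℕ × ℕ
pair zero    = 0 , 0
pair (suc n) = next-pair (pair n)

triangle : ℕ → ℕ
triangle zero    = 0
triangle (suc k) = suc k ℕ.+ triangle k

index : ℕ → ℕ → ℕ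
index i j = i ℕ.+ triangle (i ℕ.+ j)

pair-diagonal : ∀ k i j → i ℕ.+ j ≡ k → pair (i ℕ.+ triangle k) ≡ (i , j)
pair-diagonal zero    zero    zero    _    = refl
pair-diagonal (suc k) zero    (suc j) refl =
  cong next-pair (pair-diagonal k k 0 (ℕₚ.+-identityʳ k))
pair-diagonal k       (suc i) j       eq   =
  cong next-pair (pair-diagonal k i (suc j) (trans (ℕₚ.+-suc i j) eq))

pair-index : ∀ i j → pair (index i j) ≡ (i , j)
pair-index i j = pair-diagonal (i ℕ.+ j) i j refl

-- Ensures that a parent has a smaller number than its child and so is built earlier.
pair-≤ : ∀ n → proj₁ (pair n) ℕ.≤ n
pair-≤ zero = ℕ.z≤n
pair-≤ (suc n) with pair n | pair-≤ n
... | i , zero  | _ = ℕ.z≤n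
... | i , suc j | h = ℕ.s≤s h

-- The default 0 at the root is sound because stage 0 tracks the apex vertex `a` under every number.
tree-parent : ℕ → ℕ
tree-parent zero    = 0
tree-parent (suc n) = proj₁ (pair n)

tree-code : List ℕ → ℕ
tree-code []      = 0
tree-code (k ∷ σ) = suc (index (tree-code σ) k)

tree-code-injective : ∀ σ τ → tree-code σ ≡ tree-code τ → σ ≡ τ
tree-code-injective []      []      _  = refl
tree-code-injective (k ∷ σ) (l ∷ τ) eq
  with trans (sym (pair-index (tree-code σ) k))
         (trans (cong pair (ℕₚ.suc-injective eq)) (pair-index (tree-code τ) l))
... | eq′ with cong proj₂ eq′ | tree-code-injective σ τ (cong proj₁ eq′)
...   | refl | refl = refl

-- Absorbing walks into the left end; zones that never split

module Absorbing (em : ExcludedMiddle 0ℓ) (G : Graph)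
  (s₀ : TreeMinor.State em G) (stuck : ¬ TreeMinor.TStep em G s₀)
  (atoms : Atoms.HasAtoms em G) where
  open Sets em G
  open TreeMinor em G
  open Zones em G s₀ stuck atoms

  module Absorb {E₀ X₀ B : Sub} {b : Vx} (E₀-⊆ : E₀ ⊆ D₀) (E₀-B : Disj E₀ B) where

    record Inv (A C X : Sub) : Set where
      field
        zone  : Zone A B C X b
        C-⊆E₀ : C ⊆ E₀
        X₀-⊆X : X₀ ⊆ X
        X-⊆X₀ : ∀ {x} → x ∈ X → x ∈ X₀ ⊎ x ∈ E₀

    Keeps : (C C′ X : Sub) → Set
    Keeps C C′ X = ∀ {s} → s ∈ X → Thick s C → Split E₀ X₀ b ⊎ Thick s C′

    -- A vertex still in `C` is deleted as in `Delete` and stays thick by fullness; any other vertex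
    -- joins `A` and `X` with `C` unchanged.
    absorb-vertex : ∀ {A C X h e} → Inv A C X → h ∈ X → h ~ᴳ e → e ∈ E₀ →
      ∃ λ A′ → ∃ λ C′ → Inv A′ C′ (X ∪ ｛ e ｝) × C′ ⊆ C × Keeps C C′ X × (e ∈ C → Thick e C′)
    absorb-vertex {A} {C} {X} {h} {e} inv h∈ he e∈ with em {e ∈ C}
    ... | yes e∈C = _ , D.C′ ,
        record { zone = D.zone′ ; C-⊆E₀ = C-⊆E₀ ∘ ∖-⊆ ∘ D.C′-⊆ ; X₀-⊆X = ∪ˡ ∘ X₀-⊆X
               ; X-⊆X₀ = ∪-elim X-⊆X₀ (inj₂ ∘ ｛｝-⊆ e∈) } ,
        ∖-⊆ ∘ D.C′-⊆ ,
        (λ s∈ th → [ inj₁ ∘ split-weaken C-⊆E₀ X₀-⊆X X-⊆X₀ , inj₂ ]′ (D.At.split-or-thick s∈ th)) ,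
        λ _ → D.v-thick
      where
      open Inv inv
      module D = Delete zone e∈C h∈ he
    ... | no e∉C = A ∪ ｛ e ｝ , C ,
        record { zone = record { cfg = cfg′ ; iec = Z.iec ; X-⊆ = ∪-elim (∪ˡ ∘ Z.X-⊆) ∪ʳ
                               ; X-conn = conn-edge Z.X-conn conn-｛｝ h∈ self he
                               ; a = Z.a ; a∈ = ∪ˡ Z.a∈ ; a-thick = Z.a-thick
                               ; b∈ = Z.b∈ ; b-thick = Z.b-thick }
               ; C-⊆E₀ = C-⊆E₀ ; X₀-⊆X = ∪ˡ ∘ X₀-⊆X ; X-⊆X₀ = ∪-elim X-⊆X₀ (inj₂ ∘ ｛｝-⊆ e∈) } ,
        id , (λ _ → inj₂) , ⊥-elim ∘ e∉C
      where
      open Inv inv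
      module Z = Zone zone
      cfg′ : Cfg (A ∪ ｛ e ｝) B C
      cfg′ = grow-A Z.cfg (conn-edge (Cfg.A-conn Z.cfg) conn-｛｝ (Z.X-⊆ h∈) self he)
        (λ i → inj₂ (E₀-⊆ (｛｝-⊆ e∈ i) , E₀-B (｛｝-⊆ e∈ i)))
        (λ i j → e∉C (subst (_∈ C) (elim j) i))

    record Absorbed (C X : Sub) (e f : Vx) (K : Sub) : Set where
      field
        A′ C′ X′ W : Sub
        inv     : Inv A′ C′ X′
        C′-⊆    : C′ ⊆ C
        X-⊆X′   : X ⊆ X′
        keeps   : Keeps C C′ X
        e-thick : e ∈ C → Split E₀ X₀ b ⊎ Thick e C′
        W-conn  : Conn W
        e∈W     : e ∈ W
        f∈W     : f ∈ W
        W-⊆K    : W ⊆ K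
        W-⊆X′   : W ⊆ X′

    -- Vertex by vertex along the walk; `W` collects its vertices, to serve as one branch set inside
    -- `K`.
    absorb : ∀ {A C X h e f F K} → Inv A C X → h ∈ X → h ~ᴳ e → K ⊆ E₀ → Reach K F e f →
      Absorbed C X e f K
    absorb inv h∈ he i (stay e∈) with absorb-vertex inv h∈ he (i e∈)
    ... | A′ , C′ , inv′ , C-⊆ , keeps , th = record
      { A′ = A′ ; C′ = C′ ; X′ = _ ; W = ｛ _ ｝ ; inv = inv′ ; C′-⊆ = C-⊆ ; X-⊆X′ = ∪ˡ
      ; keeps = keeps ; e-thick = inj₂ ∘ th ; W-conn = conn-｛｝ ; e∈W = self ; f∈W = self
      ; W-⊆K = ｛｝-⊆ e∈ ; W-⊆X′ = ∪ʳ }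
    absorb inv h∈ he i (step e∈ ee′ _ w) with absorb-vertex inv h∈ he (i e∈)
    ... | A′ , C′ , inv′ , C-⊆ , keeps , th = record
      { A′ = R.A′ ; C′ = R.C′ ; X′ = R.X′ ; W = ｛ _ ｝ ∪ R.W ; inv = R.inv
      ; C′-⊆ = C-⊆ ∘ R.C′-⊆ ; X-⊆X′ = R.X-⊆X′ ∘ ∪ˡ
      ; keeps = λ s∈ t → [ inj₁ , R.keeps (∪ˡ s∈) ]′ (keeps s∈ t)
      ; e-thick = λ e∈C → R.keeps (∪ʳ self) (th e∈C)
      ; W-conn = conn-edge conn-｛｝ R.W-conn self R.e∈W ee′
      ; e∈W = ∪ˡ self ; f∈W = ∪ʳ R.f∈W
      ; W-⊆K = ∪-elim (｛｝-⊆ e∈) R.W-⊆K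
      ; W-⊆X′ = ∪-elim (λ j → R.X-⊆X′ (∪ʳ j)) R.W-⊆X′ }
      where module R = Absorbed (absorb inv′ (∪ʳ self) ee′ i w)

  module Based {A E X B b} (Z : Zone A B E X b) where
    open Zone Z
    open Absorb {E} {X} {B} {b} (Cfg.E-⊆ cfg) (Cfg.E-B cfg) public

    base : Inv A E X
    base = record { zone = Z ; C-⊆E₀ = id ; X₀-⊆X = id ; X-⊆X₀ = inj₁ }

  record Bypassed (E X B : Sub) (b : Vx) : Set where
    field
      A C X′ : Sub
      zone   : Zone A B C X′ b
      C-⊆    : C ⊆ E
      X-⊆    : X ⊆ X′
      X′-⊆   : ∀ {x} → x ∈ X′ → x ∈ X ⊎ x ∈ E
      f      : Vx
      f∈     : f ∈ X′
      f~b    : f ~ᴳ b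

  -- Absorbing a walk from a neighbour of the left end to a neighbour of `b` makes the two ends
  -- adjacent and still leaves a zone between them.
  bypass : ∀ {A E X B b} → Zone A B E X b → Bypassed E X B b
  bypass {A} {E} {X} {B} {b} Z with Zone.a-thick Z [] | Zone.b-thick Z []
  ... | e , e∈ , ea , _ | f , f∈ , fb , _ = record
    { A = A′ ; C = C′ ; X′ = X′ ; zone = Inv.zone inv ; C-⊆ = C′-⊆ ; X-⊆ = X-⊆X′
    ; X′-⊆ = Inv.X-⊆X₀ inv ; f = f ; f∈ = W-⊆X′ f∈W ; f~b = fb }
    where
    open Based Z
    open Absorbed (absorb base (Zone.a∈ Z) (~-sym G ea) id (Zone.iec Z e∈ f∈ []))

  -- If no step splits the zone, then every vertex that has been thick remains so, and all
  -- nodes of the tree can be carved out of the zone one after the other, with apex a.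
  module Unsplit {A E X B b} (Z : Zone A B E X b) (unsplit : ¬ Split E X b) where
    open Based Z
    open Zone Z using (a; a∈; a-thick)

    -- `track m` is the vertex to which the children of node `m` attach; it is `a` until that node
    -- is built.
    record Stage : Set where
      field
        {A′ C X′}  : Sub
        inv        : Inv A′ C X′
        a-thick′   : Thick a C
        track      : ℕ → Vx
        track∈     : ∀ m → track m ∈ X′
        track-thick : ∀ m → Thick (track m) C

    update : (ℕ → Vx) → ℕ → Vx → ℕ → Vx
    update t n e m with m ℕ.≟ n
    ... | yes _ = e
    ... | no  _ = t m

    update-all : ∀ {P : Vx → Set} {t n e} → (∀ m → P (t m)) → P e → ∀ m → P (update t n e m)
    update-all {n = n} h p m with m ℕ.≟ n
    ... | yes _ = p
    ... | no  _ = h m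

    update-new : ∀ t n e → update t n e n ≡ e
    update-new t n e with n ℕ.≟ n
    ... | yes _  = refl
    ... | no n≢n = ⊥-elim (n≢n refl)

    update-old : ∀ t n e {m} → m ≢ n → update t n e m ≡ t m
    update-old t n e {m} m≢n with m ℕ.≟ n
    ... | yes eq = ⊥-elim (m≢n eq)
    ... | no _   = refl

    record Extension (n : ℕ) (S : Stage) : Set where
      open Stage S
      field
        e f      : Vx
        W        : Sub
        after    : Stage
        W-conn   : Conn W
        e∈W      : e ∈ W
        f∈W      : f ∈ W
        e~a      : e ~ᴳ a
        f~parent : f ~ᴳ track (tree-parent n)
        W-⊆C     : W ⊆ C
        W-⊆X     : W ⊆ Stage.X′ after
        X-⊆X     : X′ ⊆ Stage.X′ after
        tracked  : Stage.track after ≡ update track n e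

    -- The new node is a walk inside the current `C` from a neighbour of `a` to a neighbour of the
    -- tracked vertex of the parent.
    extend : ∀ n S → Extension n S
    extend n S with Stage.a-thick′ S [] | Stage.track-thick S (tree-parent n) []
    ... | e , e∈ , ea , _ | f , f∈ , ft , _ = record
      { e = e ; f = f ; W = W
      ; after = record
        { inv = R.inv
        ; a-thick′ = keep (R.keeps (Inv.X₀-⊆X inv a∈) a-thick′)
        ; track = update track n e
        ; track∈ = update-all {P = _∈ R.X′} (R.X-⊆X′ ∘ track∈) (W-⊆X′ e∈W)
        ; track-thick = update-all {P = λ s → Thick s R.C′}
            (λ m → keep (R.keeps (track∈ m) (track-thick m))) (keep (R.e-thick e∈))
        }
      ; W-conn = W-conn ; e∈W = e∈W ; f∈W = f∈W ; e~a = ea ; f~parent = ft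
      ; W-⊆C = W-⊆K ; W-⊆X = W-⊆X′ ; X-⊆X = X-⊆X′ ; tracked = refl }
      where
      open Stage S
      module R = Absorbed (absorb inv (Inv.X₀-⊆X inv a∈) (~-sym G ea) (Inv.C-⊆E₀ inv)
                            (Zone.iec (Inv.zone inv) e∈ f∈ []))
      open R using (W; W-conn; e∈W; f∈W; W-⊆K; W-⊆X′; X-⊆X′)
      keep : ∀ {P : Set} → Split E X b ⊎ P → P
      keep = [ ⊥-elim ∘ unsplit , id ]′

    stage : ℕ → Stage
    extension : ∀ n → Extension n (stage n)

    stage zero    = record { inv = base ; a-thick′ = a-thick ; track = λ _ → a
                           ; track∈ = λ _ → a∈ ; track-thick = λ _ → a-thick }
    stage (suc n) = Extension.after (extension n)

    extension n = extend n (stage n)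

    open Extension

    Xₙ Cₙ : ℕ → Sub
    Xₙ n = Stage.X′ (stage n)
    Cₙ n = Stage.C (stage n)

    X-mono : ∀ {m n} → m ℕ.≤ n → Xₙ m ⊆ Xₙ n
    X-mono {m} {zero}  ℕ.z≤n = id
    X-mono {m} {suc n} m≤ with ℕₚ.m≤n⇒m<n∨m≡n m≤
    ... | inj₁ (ℕ.s≤s m≤n) = X-⊆X (extension n) ∘ X-mono m≤n
    ... | inj₂ refl        = id

    C-X : ∀ n → Disj (Cₙ n) (Xₙ n)
    C-X n i j = Cfg.E-A (Zone.cfg zone) i (Zone.X-⊆ zone j)
      where open Inv (Stage.inv (stage n))

    Wₙ : ℕ → Sub
    Wₙ n = W (extension n)

    -- The earlier node has been absorbed into the left end, whereas the later one is carved out of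
    -- the remaining zone.
    W-apart-< : ∀ {m n} → m ℕ.< n → Disj (Wₙ m) (Wₙ n)
    W-apart-< {m} {n} m<n i j =
      C-X n (W-⊆C (extension n) j) (X-mono m<n (W-⊆X (extension m) i))

    W-apart : ∀ {m n x} → x ∈ Wₙ m → x ∈ Wₙ n → m ≡ n
    W-apart {m} {n} i j with ℕₚ.<-cmp m n
    ... | tri< m<n _ _ = ⊥-elim (W-apart-< m<n i j)
    ... | tri≈ _ eq _  = eq
    ... | tri> _ _ n<m = ⊥-elim (W-apart-< n<m j i)

    a∉W : ∀ n → a ∉ Wₙ n
    a∉W n i = C-X n (W-⊆C (extension n) i) (Inv.X₀-⊆X (Stage.inv (stage n)) a∈)

    track-e : ∀ {m n} → m ℕ.< n → Stage.track (stage n) m ≡ e (extension m)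
    track-e {m} {suc n} (ℕ.s≤s m≤n) =
      trans (cong (λ t → t m) (tracked (extension n))) (recent (ℕₚ.m≤n⇒m<n∨m≡n m≤n))
      where
      recent : m ℕ.< n ⊎ m ≡ n →
        update (Stage.track (stage n)) n (e (extension n)) m ≡ e (extension m)
      recent (inj₁ m<n)  = trans
        (update-old (Stage.track (stage n)) n (e (extension n)) (ℕₚ.<⇒≢ m<n)) (track-e m<n)
      recent (inj₂ refl) = update-new (Stage.track (stage n)) n (e (extension n))

    code-edge : ∀ k σ → ∃ λ x → ∃ λ y → x ∈ Wₙ (tree-code σ) × y ∈ Wₙ (tree-code (k ∷ σ)) × x ~ᴳ y
    code-edge k σ = e (extension (tree-code σ)) , f (extension n) , e∈W (extension (tree-code σ))
                  , f∈W (extension n) , ~-sym G (subst (f (extension n) ~ᴳ_) eq (f~parent (extension n)))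
      where
      n : ℕ
      n = tree-code (k ∷ σ)
      par : tree-parent n ≡ tree-code σ
      par = cong proj₁ (pair-index (tree-code σ) k)
      eq : Stage.track (stage n) (tree-parent n) ≡ e (extension (tree-code σ))
      eq = trans (track-e {n = n} (ℕ.s≤s (pair-≤ (index (tree-code σ) k))))
             (cong (e ∘ extension) par)

    branch : Maybe (List ℕ) → Vx → Set
    branch (just σ) x = x ∈ Wₙ (tree-code σ)
    branch nothing  x = x ≡ a

    minor : T-ℵ₀*t ≼ G
    minor = record
      { branch    = branch
      ; disjoint  = λ {h} {h′} → disj {h} {h′}
      ; nonempty  = λ { (just σ) → _ , e∈W (extension (tree-code σ)) ; nothing → a , refl }
      ; connected = λ { (just σ) x∈ y∈ → relax id (W-conn (extension (tree-code σ)) x∈ y∈)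
                      ; nothing refl refl → stay refl }
      ; edges     = edges
      }
      where
      disj : ∀ {h h′ x} → branch h x → branch h′ x → h ≡ h′
      disj {just σ}  {just τ}  i j = cong just (tree-code-injective σ τ (W-apart i j))
      disj {just σ}  {nothing} i refl = ⊥-elim (a∉W (tree-code σ) i)
      disj {nothing} {just σ}  refl i = ⊥-elim (a∉W (tree-code σ) i)
      disj {nothing} {nothing} _ _ = refl
      edges : ∀ {h h′} → TtAdj h h′ → ∃ λ x → ∃ λ y → branch h x × branch h′ y × x ~ᴳ y
      edges (tree (down n σ)) = code-edge n σ
      edges (tree (up n σ))   = let x , y , i , j , xy = code-edge n σ in y , x , j , i , ~-sym G xy
      edges (apexˡ σ)         = a , _ , refl , e∈W (extension (tree-code σ)) , ~-sym G (e~a (extension (tree-code σ)))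
      edges (apexʳ σ)         = _ , a , e∈W (extension (tree-code σ)) , refl , e~a (extension (tree-code σ))

-- The Farey graph from repeated splitting

Word : Set
Word = List Bool

-- Words address the intervals of the Stern–Brocot subdivision of the circle, and just σ stands
-- for the point that subdivides the interval σ.  The last letter applied is the head; false is
-- the left half.
lo ro : Word → Maybe Word
lo []          = nothing
lo (false ∷ σ) = lo σ
lo (true  ∷ σ) = just σ
ro []          = nothing
ro (false ∷ σ) = just σ
ro (true  ∷ σ) = ro σ

-- Two points bounding a common interval of the subdivision, in either order: the form that Farey
-- adjacency takes for codes.
Interval : Maybe Word → Maybe Word → Set
Interval m m′ = ∃ λ τ → (lo τ ≡ m × ro τ ≡ m′) ⊎ (lo τ ≡ m′ × ro τ ≡ m)

record FareyCoding : Set where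
  field
    code           : Maybe ℚ → Maybe Word
    code-injective : ∀ {p q} → code p ≡ code q → p ≡ q
    code-adjacent  : ∀ {p q} → FareyAdj p q → Interval (code p) (code q)

module FareyMinor (em : ExcludedMiddle 0ℓ) (G : Graph)
  (s₀ : TreeMinor.State em G) (stuck : ¬ TreeMinor.TStep em G s₀)
  (atoms : Atoms.HasAtoms em G) (coding : FareyCoding) where
  open Sets em G
  open TreeMinor em G
  open Atoms em G
  open Zones em G s₀ stuck atoms
  open FareyCoding coding

  Linked : Sub → Vx → Set
  Linked X b = ∃ λ f → f ∈ X × f ~ᴳ b

  module Subdivide
    (split : ∀ {E a b} → Zone₁ E a b → Σ (Split E ｛ a ｝ b) λ s → Linked (Split.X′ s) b)
    {E₀ a₀ b₀} (Z₀ : Zone₁ E₀ a₀ b₀) where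

    record Place : Set where
      constructor place
      field
        {E}  : Sub
        {a b} : Vx
        zone : Zone₁ E a b

    halve : Bool → Place → Place
    halve false P = place (Split.left (proj₁ (split (Place.zone P))))
    halve true  P = place (Split.right (proj₁ (split (Place.zone P))))

    places : Word → Place
    places []      = place Z₀
    places (k ∷ σ) = halve k (places σ)

    E : Word → Sub
    E σ = Place.E (places σ)

    a b : Word → Vx
    a σ = Place.a (places σ)
    b σ = Place.b (places σ)

    S : ∀ σ → Split (E σ) ｛ a σ ｝ (b σ)
    S σ = proj₁ (split (Place.zone (places σ)))

    X : Word → Sub
    X σ = Split.X′ (S σ)

    w : Word → Vx
    w σ = Split.w (S σ)

    linked : ∀ σ → Linked (X σ) (b σ)
    linked σ = proj₂ (split (Place.zone (places σ)))

    nest : ∀ {k σ x} → x ∈ E (k ∷ σ) → x ∈ E σ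
    nest {false} {σ} = Split.E₁-⊆ (S σ)
    nest {true}  {σ} = Split.E₂-⊆ (S σ)

    apart : ∀ {k l σ x} → k ≢ l → x ∈ E (k ∷ σ) → x ∈ E (l ∷ σ) → ⊥
    apart {false} {false}     k≢l _ _ = k≢l refl
    apart {true}  {true}      k≢l _ _ = k≢l refl
    apart {false} {true}  {σ} _   i j = Split.E₁-E₂ (S σ) i j
    apart {true}  {false} {σ} _   i j = Split.E₁-E₂ (S σ) j i

    open Nested Bool._≟_ (λ σ x → x ∈ E σ) (λ {k} {σ} → nest {k} {σ})
      (λ {k} {l} {σ} → apart {k} {l} {σ})

    w-own : ∀ σ → Own σ (w σ)
    w-own σ = Split.w∈ (S σ) , λ { false → Split.w∉E₁ (S σ) ; true → Split.w∉E₂ (S σ) }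

    X-own : ∀ σ {x} → x ∈ X σ → x ∈ E σ → Own σ x
    X-own σ x∈ x∈E = x∈E , λ { false i → Split.E₁-X′ (S σ) i x∈ ; true i → Split.E₂-X′ (S σ) i x∈ }

    a∈X : ∀ σ → a σ ∈ X σ
    a∈X σ = Split.X-⊆ (S σ) self

    a₀∉ : a₀ ∉ E []
    a₀∉ i = let _ , _ , Z = Z₀ in
      Cfg.E-A (Zone.cfg Z) i (Zone.X-⊆ Z self)

    b₀∉ : b₀ ∉ E []
    b₀∉ i = let _ , _ , Z = Z₀ in Cfg.E-B (Zone.cfg Z) i (Zone.b∈ Z)

    -- A point collects its own vertex and the left ends of all intervals that start at it. The
    -- outermost interval has both ends at `nothing`, so `a₀` and `b₀` share a branch set.
    branch : Maybe Word → Vx → Set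
    branch m x = (m ≡ nothing × x ≡ b₀) ⊎ (∃ λ σ → m ≡ just σ × x ≡ w σ) ⊎ (∃ λ τ → lo τ ≡ m × x ∈ X τ)

    -- A normal form for membership: the sets `X τ` overlap, but a vertex of `E []` has one owner
    -- `σ`, for which it is either the new point `w σ` or absorbed by the left end.
    data Cell (m : Maybe Word) (x : Vx) : Set where
      outer : m ≡ nothing → x ∉ E [] → Cell m x
      inner : ∀ σ → Own σ x → (m ≡ just σ × x ≡ w σ) ⊎ (m ≡ lo σ × x ∈ X σ) → Cell m x

    -- The only vertex of `X τ` outside `E τ` is `a τ`. In a left half it lies in the left end of
    -- the parent, in a right half it is the parent's new point.
    cell-X : ∀ τ {x} → x ∈ X τ → Cell (lo τ) x
    cell-X τ x∈ with Split.X′-⊆ (S τ) x∈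
    ... | inj₂ x∈E = inner τ (X-own τ x∈ x∈E) (inj₂ (refl , x∈))
    cell-X []          x∈ | inj₁ i with elim i
    ...   | refl = outer refl a₀∉
    cell-X (false ∷ σ) x∈ | inj₁ i with elim i
    ...   | refl = cell-X σ (Split.a∈ (S σ))
    cell-X (true ∷ σ)  x∈ | inj₁ i with elim i
    ...   | refl = inner σ (w-own σ) (inj₁ (refl , refl))

    cell : ∀ {m x} → branch m x → Cell m x
    cell (inj₁ (refl , refl))            = outer refl b₀∉
    cell (inj₂ (inj₁ (σ , refl , refl))) = inner σ (w-own σ) (inj₁ (refl , refl))
    cell (inj₂ (inj₂ (τ , refl , x∈)))   = cell-X τ x∈

    cell-unique : ∀ {m m′ x} → Cell m x → Cell m′ x → m ≡ m′
    cell-unique (outer eq _)      (outer eq′ _)      = trans eq (sym eq′)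
    cell-unique (outer _ x∉)      (inner σ (h , _) _) = ⊥-elim (x∉ (to-root σ h))
    cell-unique (inner σ (h , _) _) (outer _ x∉)      = ⊥-elim (x∉ (to-root σ h))
    cell-unique (inner σ o c) (inner τ o′ c′) with own-unique {σ} {τ} o o′
    cell-unique (inner σ o (inj₁ (eq , _))) (inner _ _ (inj₁ (eq′ , _))) | refl = trans eq (sym eq′)
    cell-unique (inner σ o (inj₂ (eq , _))) (inner _ _ (inj₂ (eq′ , _))) | refl = trans eq (sym eq′)
    cell-unique (inner σ o (inj₁ (_ , refl))) (inner _ _ (inj₂ (_ , i))) | refl =
      ⊥-elim (Split.w∉X′ (S σ) i)
    cell-unique (inner σ o (inj₂ (_ , i))) (inner _ _ (inj₁ (_ , refl))) | refl =
      ⊥-elim (Split.w∉X′ (S σ) i)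

    centre : Maybe Word → Vx
    centre nothing  = b₀
    centre (just σ) = w σ

    centre∈ : ∀ m → branch m (centre m)
    centre∈ nothing  = inj₁ (refl , refl)
    centre∈ (just σ) = inj₂ (inj₁ (σ , refl , refl))

    WalkIn : Maybe Word → Vx → Vx → Set
    WalkIn m = Walk G (branch m) (λ _ _ → ⊤)

    within : ∀ τ {x y} → x ∈ X τ → y ∈ X τ → WalkIn (lo τ) x y
    within τ x∈ y∈ = relax (λ i → inj₂ (inj₂ (τ , refl , i))) (Split.X′-conn (S τ) x∈ y∈)

    inward : ∀ τ {x} → x ∈ X τ → WalkIn (lo τ) x (centre (lo τ))
    -- The link of the outermost interval joins its left end to `b₀` and thus closes the circle.
    inward [] x∈ = let f , f∈ , e = linked [] in
      within [] x∈ f∈ ▷ step (inj₂ (inj₂ ([] , refl , f∈))) e tt (stay (centre∈ nothing))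
    inward (false ∷ σ) x∈ = within (false ∷ σ) x∈ (a∈X (false ∷ σ)) ▷ inward σ (Split.a∈ (S σ))
    inward (true  ∷ σ) x∈ = within (true ∷ σ) x∈ (a∈X (true ∷ σ))

    to-centre : ∀ {m x} → branch m x → WalkIn m x (centre m)
    to-centre (inj₁ (refl , refl))            = stay (centre∈ nothing)
    to-centre (inj₂ (inj₁ (σ , refl , refl))) = stay (centre∈ (just σ))
    to-centre (inj₂ (inj₂ (τ , refl , x∈)))   = inward τ x∈

    b-branch : ∀ τ → branch (ro τ) (b τ)
    b-branch []          = inj₁ (refl , refl)
    b-branch (false ∷ σ) = inj₂ (inj₁ (σ , refl , refl))
    b-branch (true  ∷ σ) = b-branch σ

    interval-edge : ∀ {m m′} → Interval m m′ →
      ∃ λ x → ∃ λ y → branch m x × branch m′ y × x ~ᴳ y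
    interval-edge (τ , inj₁ (refl , refl)) = let f , f∈ , e = linked τ in
      f , b τ , inj₂ (inj₂ (τ , refl , f∈)) , b-branch τ , e
    interval-edge (τ , inj₂ (refl , refl)) = let f , f∈ , e = linked τ in
      b τ , f , b-branch τ , inj₂ (inj₂ (τ , refl , f∈)) , ~-sym G e

    minor : Farey ≼ G
    minor = record
      { branch    = branch ∘ code
      ; disjoint  = λ i j → code-injective (cell-unique (cell i) (cell j))
      ; nonempty  = λ p → centre (code p) , centre∈ (code p)
      ; connected = λ p i j → to-centre i ▷ back (to-centre j)
      ; edges     = λ {p} {q} e → interval-edge (code-adjacent {p} {q} e)
      }

  -- A stuck state has an atomic class at its seed. After `u₀` is deleted from it, `z₀` either finds
  -- a class there or spreads over pieces, one of which is thickened from its hook.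
  initial-zone : ∃ λ E → ∃ λ a → ∃ λ b → Zone₁ E a b
  initial-zone = from-at (dne λ na → stuck (scatter-step s₀ na))
    where
    open State s₀
    from-at : Atomic D₀ u₀ → ∃ λ E → ∃ λ a → ∃ λ b → Zone₁ E a b
    from-at at = [ found , spread ]′
      (finds-or-spreads (root∉ ∘ L-⊆) (thick-minus (cls-thick seed∈ full at)))
      where
      L : Sub
      L = Cls D₀ u₀ − u₀
      L-⊆ : L ⊆ D₀
      L-⊆ = cls-⊆ ∘ ∖-⊆
      full-u : Full L u₀
      full-u = full-minus (cls-iec at) (cls-self seed∈)
      cfg : Cfg ｛ z₀ ｝ ｛ u₀ ｝ L
      cfg = record
        { A-conn = conn-｛｝ ; B-conn = conn-｛｝
        ; A-B = λ i j → root∉ (subst (_∈ D₀) (trans (sym (elim j)) (elim i)) seed∈)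
        ; z₀∈A = self ; u₀∈B = self ; A-⊆ = inj₁ ∘ elim ; B-⊆ = ｛｝-⊆ seed∈ ; E-⊆ = L-⊆
        ; E-A = λ i j → root∉ (subst (_∈ D₀) (elim j) (L-⊆ i)) ; E-B = ∖-∉ }
      found : Finds z₀ L → ∃ λ E → ∃ λ a → ∃ λ b → Zone₁ E a b
      found (t , t∈ , at′ , th) =
        _ , _ , _ , zone₁ (shrink cfg cls-⊆) (cls-iec at′) self th self (cls-thick t∈ full-u at′)
      spread : Spreads z₀ L → ∃ λ E → ∃ λ a → ∃ λ b → Zone₁ E a b
      spread sp = _ , _ , _ , Thickened.zone
        (thicken
          (grow-A (shrink cfg comp-⊆) (conn-meet conn-｛｝ Q-conn self x∈Q)
            (λ i → [ (λ { refl → inj₁ self }) , (λ j → inj₂ (L-⊆ j , ∖-∉ j)) ]′ (Q-⊆ i)) (avoid 0))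
          comp-conn (full-comp full-u) self (∪ʳ (hook∈ 0)) (comp-self (seed∈′ 0)) (link 0))
        where
        open Spreads sp
        open Scatter scat renaming (seed∈ to seed∈′)

-- One of the two minors always exists

module Dichotomy (em : ExcludedMiddle 0ℓ) (coding : FareyCoding) (G : Graph) where
  open Sets em G
  open TreeMinor em G
  open Atoms em G

  module FromStuck (s₀ : State) (stuck : ¬ TStep s₀) (atoms : HasAtoms) where
    open Zones em G s₀ stuck atoms
    open Absorbing em G s₀ stuck atoms
    open FareyMinor em G s₀ stuck atoms coding

    minor : Farey ≼ G ⊎ T-ℵ₀*t ≼ G
    minor with em {∃ λ A → ∃ λ B → ∃ λ E → ∃ λ X → ∃ λ b → Zone A B E X b × ¬ Split E X b}
    ... | yes (_ , _ , _ , _ , _ , Z , unsplit) = inj₂ (Unsplit.minor Z unsplit)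
    ... | no  ¬unsplit = inj₁ (Subdivide.minor split (proj₂ (proj₂ (proj₂ initial-zone))))
      where
      split : ∀ {E a b} → Zone₁ E a b → Σ (Split E ｛ a ｝ b) λ s → Linked (Split.X′ s) b
      -- The bypass comes first: splitting only enlarges the left end, so its edge to `b` survives.
      split (_ , _ , Z) = let s = dne λ ns → ¬unsplit (_ , _ , _ , _ , _ , zone , ns) in
        split-weaken C-⊆ X-⊆ X′-⊆ s , f , Split.X-⊆ s f∈ , f~b
        where open Bypassed (bypass Z)

  -- Three cases: some full set is atomless; atoms always exist but some state is stuck; every state
  -- admits a step.
  minor : InfEdgeConnected G → Farey ≼ G ⊎ T-ℵ₀*t ≼ G
  minor ((a , b , a≢b) , walks)
    with em {∃ λ D → ∃ λ z → ∃ λ u → z ∉ D × Full D z × u ∈ D × Atomless D}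
  ... | yes (D , z , u , z∉ , full , u∈ , al) = inj₂ (atomless-minor z∉ full u∈ al)
  ... | no ¬atomless with em {∃ λ s → ¬ TStep s}
  ...   | yes (s , stuck) = FromStuck.minor s stuck λ z∉ full u∈ →
          dne λ none′ → ¬atomless (_ , _ , _ , z∉ , full , u∈ , λ v∈ at → none′ (_ , v∈ , at))
  ...   | no ¬stuck = inj₂ (Grow.minor (λ _ → ⊤)
          (λ s _ → dne (λ n → ¬stuck (s , n)) , λ _ → tt) s₀ tt)
    where
    U : Sub
    U = ⟦ (λ _ → ⊤) ⟧
    iec : IEC U
    iec {x} {y} x∈ _ F with em {x ≡ y}
    ... | yes refl = stay x∈
    ... | no  x≢y  = lift (walks F x y x≢y)
      where
      lift : ∀ {x y} → Walk G (λ _ → ⊤) (λ x y → ¬ EdgeIn x y F) x y → Reach U F x y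
      lift (stay _)       = stay (intro tt)
      lift (step _ e n w) = step (intro tt) e n (lift w)
    b∈ : b ∈ U − a
    b∈ = −-intro (intro tt) (a≢b ∘ sym)
    s₀ : State
    s₀ = record
      { dom = Comp (U − a) [] b ; root = a ; seed = b ; seed∈ = comp-self b∈
      ; root∉ = λ i → −-≢ (comp-⊆ i) refl ; full = full-comp (full-minus iec (intro tt))
      ; conn = comp-conn }

-- Coding the Farey graph by the Stern-Brocot subdivision

-- Loc σ v u ρ: starting in the interval σ with ends L and R, the subtractive Euclidean
-- algorithm finds that v L + u R is the mediant of the interval ρ.
data Loc (σ : Word) : ℕ → ℕ → Word → Set where
  mid   : Loc σ 1 1 σ
  right : ∀ {v u ρ} → Loc (true ∷ σ) v u ρ → Loc σ v (v + u) ρ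
  left  : ∀ {v u ρ} → Loc (false ∷ σ) v u ρ → Loc σ (u + v) u ρ

loc-pos : ∀ {σ v u ρ} → Loc σ v u ρ → (∃ λ m → v ≡ suc m) × (∃ λ n → u ≡ suc n)
loc-pos mid = (0 , refl) , (0 , refl)
loc-pos (right l) with loc-pos l
... | (m , refl) , (n , refl) = (m , refl) , (_ , refl)
loc-pos (left l) with loc-pos l
... | (m , refl) , (n , refl) = (_ , refl) , (n , refl)

-- Each subtraction lowers the sum, so `n` suffices as fuel; equal coprime numbers are both 1.
euclid : ∀ n {v u} σ → v + u ℕ.≤ n → Coprime (suc v) (suc u) → ∃ λ ρ → Loc σ (suc v) (suc u) ρ
euclid n {v} {u} σ v+u≤n cop with ℕ.compare v u
... | ℕ.equal .v with cop {suc v} (∣-refl , ∣-refl)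
...   | refl = σ , mid
euclid (suc n) σ v+u≤n cop | ℕ.less v k
  with euclid n (true ∷ σ) (ℕₚ.≤-trans (ℕₚ.+-monoʳ-≤ v (ℕₚ.m≤n+m k v)) (ℕₚ.≤-pred (subst (ℕ._≤ suc n) (ℕₚ.+-suc v (v + k)) v+u≤n)))
         (λ {d} (d∣v , d∣k) → cop (d∣v , subst (d ∣_) (cong suc (ℕₚ.+-suc v k)) (∣m∣n⇒∣m+n d∣v d∣k)))
... | ρ , l = ρ , subst (λ u → Loc σ (suc v) u ρ) (cong suc (ℕₚ.+-suc v k)) (right l)
euclid zero σ v+u≤n cop | ℕ.less v k with ℕₚ.≤-trans (ℕₚ.m≤n+m (suc (v + k)) v) v+u≤n
... | ()
euclid (suc n) σ v+u≤n cop | ℕ.greater u k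
  with euclid n (false ∷ σ) (ℕₚ.≤-trans (ℕₚ.+-monoˡ-≤ u (ℕₚ.m≤n+m k u)) (ℕₚ.≤-pred v+u≤n))
         (λ {d} (d∣k , d∣u) → cop (subst (d ∣_) (cong suc (ℕₚ.+-suc u k)) (∣m∣n⇒∣m+n d∣u d∣k) , d∣u))
... | ρ , l = ρ , subst (λ v → Loc σ v (suc u) ρ) (cong suc (ℕₚ.+-suc u k)) (left l)

_⊒_ : Word → Word → Set
ρ ⊒ σ = σ ≡ ρ ⊎ Above σ ρ

⊒-step : ∀ {ρ σ k} → ρ ⊒ (k ∷ σ) → Above σ ρ
⊒-step (inj₁ refl)      = parent
⊒-step (inj₂ parent)    = later parent
⊒-step (inj₂ (later a)) = later (⊒-step (inj₂ a))

loc-⊒ : ∀ {σ v u ρ} → Loc σ v u ρ → ρ ⊒ σ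
loc-⊒ mid       = inj₁ refl
loc-⊒ (right l) = inj₂ (⊒-step (loc-⊒ l))
loc-⊒ (left l)  = inj₂ (⊒-step (loc-⊒ l))

⊒-length : ∀ {ρ σ} → ρ ⊒ σ → length σ ℕ.≤ length ρ
⊒-length (inj₁ refl) = ℕₚ.≤-refl
⊒-length (inj₂ a)    = ℕₚ.<⇒≤ (above-length a)

⊒-unique : ∀ {ρ σ τ} → ρ ⊒ σ → ρ ⊒ τ → length σ ≡ length τ → σ ≡ τ
⊒-unique (inj₁ refl)      (inj₁ refl)      _  = refl
⊒-unique (inj₁ refl)      (inj₂ a)         eq = ⊥-elim (ℕₚ.<-irrefl (sym eq) (above-length a))
⊒-unique (inj₂ a)         (inj₁ refl)      eq = ⊥-elim (ℕₚ.<-irrefl eq (above-length a))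
⊒-unique (inj₂ parent)    (inj₂ parent)    _  = refl
⊒-unique (inj₂ parent)    (inj₂ (later a)) eq = ⊥-elim (ℕₚ.<-irrefl (sym eq) (above-length a))
⊒-unique (inj₂ (later a)) (inj₂ parent)    eq = ⊥-elim (ℕₚ.<-irrefl eq (above-length a))
⊒-unique (inj₂ (later a)) (inj₂ (later b)) eq = ⊒-unique (inj₂ a) (inj₂ b) eq

halves-differ : ∀ {σ v u v′ u′ ρ} → Loc (true ∷ σ) v u ρ → ¬ Loc (false ∷ σ) v′ u′ ρ
halves-differ l l′ with ⊒-unique (loc-⊒ l) (loc-⊒ l′) refl
... | ()

mid-not-below : ∀ {σ v u k} → ¬ Loc (k ∷ σ) v u σ
mid-not-below l = ℕₚ.<-irrefl refl (⊒-length (loc-⊒ l))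

-- The letters of `ρ` beyond `σ` record every step of the algorithm, so the coefficients can be
-- recovered.
loc-unique : ∀ {σ v u v′ u′ ρ} → Loc σ v u ρ → Loc σ v′ u′ ρ → v ≡ v′ × u ≡ u′
loc-unique mid       mid        = refl , refl
loc-unique mid       (right l)  = ⊥-elim (mid-not-below l)
loc-unique mid       (left l)   = ⊥-elim (mid-not-below l)
loc-unique (right l) mid        = ⊥-elim (mid-not-below l)
loc-unique (left l)  mid        = ⊥-elim (mid-not-below l)
loc-unique (right l) (left l′)  = ⊥-elim (halves-differ l l′)
loc-unique (left l)  (right l′) = ⊥-elim (halves-differ l′ l)
loc-unique (right l) (right l′) with loc-unique l l′
... | refl , refl = refl , refl
loc-unique (left l)  (left l′) with loc-unique l l′
... | refl , refl = refl , refl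

-- A `left` step would make the first coefficient at least 2. With `right` steps only, the right end
-- never moves, and the right half of the last interval is the one sought.
at-right-end : ∀ {σ u ρ} → Loc σ 1 u ρ → ∃ λ τ → lo τ ≡ just ρ × ro τ ≡ ro σ
at-right-end l = go l refl
  where
  go : ∀ {σ v u ρ} → Loc σ v u ρ → v ≡ 1 → ∃ λ τ → lo τ ≡ just ρ × ro τ ≡ ro σ
  go {σ} mid _     = true ∷ σ , refl , refl
  go (right l) eq = go l eq
  go (left l)  eq with loc-pos l
  ... | (m , refl) , (n , refl) with ℕₚ.m+n≡0⇒n≡0 n (ℕₚ.suc-injective eq)
  ...   | ()

at-left-end : ∀ {σ v ρ} → Loc σ v 1 ρ → ∃ λ τ → lo τ ≡ lo σ × ro τ ≡ just ρ
at-left-end l = go l refl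
  where
  go : ∀ {σ v u ρ} → Loc σ v u ρ → u ≡ 1 → ∃ λ τ → lo τ ≡ lo σ × ro τ ≡ just ρ
  go {σ} mid _     = false ∷ σ , refl , refl
  go (left l)  eq = go l eq
  go (right l) eq with loc-pos l
  ... | (m , refl) , (n , refl) with ℕₚ.m+n≡0⇒n≡0 m (ℕₚ.suc-injective eq)
  ...   | ()

interval-sym : ∀ {m m′} → Interval m m′ → Interval m′ m
interval-sym (τ , h) = τ , Sum.swap h

-- Two points v L + u R and v′ L + u′ R with u v′ − u′ v = 1.
loc-adjacent : ∀ {σ v u ρ v′ u′ ρ′} → Loc σ v u ρ → Loc σ v′ u′ ρ′ → u * v′ ≡ suc (u′ * v) →
  Interval (just ρ) (just ρ′)
loc-adjacent mid mid ()
loc-adjacent mid (right {v} {u} l) eq = ⊥-elim (ℕₚ.<-irrefl eq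
  (ℕ.s≤s (ℕₚ.≤-trans (ℕₚ.≤-reflexive (ℕₚ.+-identityʳ v))
    (ℕₚ.≤-trans (ℕₚ.m≤m+n v u) (ℕₚ.≤-reflexive (sym (ℕₚ.*-identityʳ (v + u))))))))
-- The equation forces `v` to be 1, so the second point is next to the right end of the left half,
-- which is the mediant itself.
loc-adjacent {σ} mid (left {v} {u} l) eq
  with ℕₚ.+-cancelˡ-≡ u v 1 (trans (sym (ℕₚ.+-identityʳ (u + v)))
         (trans eq (trans (cong suc (ℕₚ.*-identityʳ u)) (ℕₚ.+-comm 1 u))))
... | refl with at-right-end l
...   | τ , e , e′ = τ , inj₂ (e , e′)
loc-adjacent (right {v} {u} l) mid eq
  with ℕₚ.+-cancelˡ-≡ v u 1 (trans (sym (ℕₚ.*-identityʳ (v + u)))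
         (trans eq (trans (cong suc (ℕₚ.+-identityʳ v)) (ℕₚ.+-comm 1 v))))
... | refl with at-left-end l
...   | τ , e , e′ = τ , inj₂ (e , e′)
loc-adjacent (left {v} {u} l) mid eq = ⊥-elim (ℕₚ.<-irrefl eq
  (ℕ.s≤s (ℕₚ.≤-trans (ℕₚ.≤-reflexive (ℕₚ.*-identityʳ u))
    (ℕₚ.≤-trans (ℕₚ.m≤m+n u v) (ℕₚ.≤-reflexive (sym (ℕₚ.+-identityʳ (u + v))))))))
-- Within one half, the subtraction leaves the determinant unchanged.
loc-adjacent (right {v} {u} l) (right {v′} {u′} l′) eq = loc-adjacent l l′
  (ℕₚ.+-cancelˡ-≡ (v * v′) _ _ (trans (sym (ℕₚ.*-distribʳ-+ v′ v u))
    (trans eq (trans (cong suc (trans (ℕₚ.*-distribʳ-+ v v′ u′) (cong (_+ u′ * v) (ℕₚ.*-comm v′ v))))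
      (sym (ℕₚ.+-suc (v * v′) (u′ * v)))))))
loc-adjacent (left {v} {u} l) (left {v′} {u′} l′) eq = loc-adjacent l l′
  (ℕₚ.+-cancelˡ-≡ (u * u′) _ _ (trans (sym (ℕₚ.*-distribˡ-+ u u′ v′))
    (trans eq (trans (cong suc (trans (ℕₚ.*-distribˡ-+ u′ u v) (cong (_+ u′ * v) (ℕₚ.*-comm u′ u))))
      (sym (ℕₚ.+-suc (u * u′) (u′ * v)))))))
-- In different halves the determinant is at least 3, or negative in the opposite order.
loc-adjacent (right l) (left l′) eq with loc-pos l | loc-pos l′
... | (v , refl) , (u , refl) | (v′ , refl) , (u′ , refl) = ⊥-elim (ℕₚ.<-irrefl (sym eq)
  (subst (suc (suc u′ * suc v) ℕ.<_) (sym (expand v u v′ u′)) (ℕₚ.m≤m+n _ _)))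
  where
  open +-*-Solver
  expand : ∀ v u v′ u′ → (suc v + suc u) * (suc u′ + suc v′) ≡
    suc (suc (suc u′ * suc v)) + (suc (v + v′ + v * v′ + u′ + u + u + u * u′ + v′ + u * v′))
  expand = solve 4 (λ v u v′ u′ →
    ((con 1 :+ v) :+ (con 1 :+ u)) :* ((con 1 :+ u′) :+ (con 1 :+ v′)) :=
    (con 2 :+ (con 1 :+ u′) :* (con 1 :+ v)) :+
      (con 1 :+ (v :+ v′ :+ v :* v′ :+ u′ :+ u :+ u :+ u :* u′ :+ v′ :+ u :* v′))) refl
loc-adjacent (left l) (right l′) eq with loc-pos l | loc-pos l′
... | (v , refl) , (u , refl) | (v′ , refl) , (u′ , refl) = ⊥-elim (ℕₚ.<-irrefl eq
  (subst (suc (suc u * suc v′) ℕ.≤_) (sym (expand v u v′ u′)) (ℕₚ.m≤m+n _ _)))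
  where
  open +-*-Solver
  expand : ∀ v u v′ u′ → suc ((suc v′ + suc u′) * (suc u + suc v)) ≡
    suc (suc u * suc v′) + (suc u′ * (suc u + suc v) + suc v′ * suc v)
  expand = solve 4 (λ v u v′ u′ →
    con 1 :+ ((con 1 :+ v′) :+ (con 1 :+ u′)) :* ((con 1 :+ u) :+ (con 1 :+ v)) :=
    (con 1 :+ (con 1 :+ u) :* (con 1 :+ v′)) :+
      ((con 1 :+ u′) :* ((con 1 :+ u) :+ (con 1 :+ v)) :+ (con 1 :+ v′) :* (con 1 :+ v))) refl

consecutive : ∀ a b → ∣ a ⊖ b ∣ ≡ 1 → a ≡ suc b ⊎ b ≡ suc a
consecutive zero    zero    ()
consecutive (suc a) zero    eq = inj₁ eq
consecutive zero    (suc b) eq = inj₂ eq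
consecutive (suc a) (suc b) eq = Sum.map (cong suc) (cong suc)
  (consecutive a b (trans (cong ∣_∣ (sym (ℤₚ.[1+m]⊖[1+n]≡m⊖n a b))) eq))

-- Between 0/1 and 1/0 the coefficients are the denominator and the numerator. On the negative side
-- the ends are -1/0 and 0/1, whence the other order in `locate⁻`.
locate⁺ : ∀ x d → .(Coprime (suc x) (suc d)) → ∃ λ ρ → Loc (true ∷ []) (suc d) (suc x) ρ
locate⁺ x d c = euclid (d + x) (true ∷ []) ℕₚ.≤-refl (Coprimality.sym (recompute c))

locate⁻ : ∀ x d → .(Coprime (suc x) (suc d)) → ∃ λ ρ → Loc (false ∷ []) (suc x) (suc d) ρ
locate⁻ x d c = euclid (x + d) (false ∷ []) ℕₚ.≤-refl (recompute c)

word : ℚ → Word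
word (mkℚ +0       d c) = []
word (mkℚ +[1+ x ] d c) = proj₁ (locate⁺ x d c)
word (mkℚ -[1+ x ] d c) = proj₁ (locate⁻ x d c)

zero-den : ∀ d → .(Coprime 0 (suc d)) → d ≡ 0
zero-den d c = ℕₚ.suc-injective (recompute c (suc d ∣0 , ∣-refl))

word-injective : ∀ p q → word p ≡ word q → p ≡ q
word-injective (mkℚ +0 d c) (mkℚ +0 d′ c′) _ with zero-den d c | zero-den d′ c′
... | refl | refl = refl
word-injective (mkℚ +0 d c) (mkℚ +[1+ x ] d′ c′) eq with locate⁺ x d′ c′
word-injective (mkℚ +0 d c) (mkℚ +[1+ x ] d′ c′) refl | _ , l = ⊥-elim (mid-not-below l)
word-injective (mkℚ +0 d c) (mkℚ -[1+ x ] d′ c′) eq with locate⁻ x d′ c′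
word-injective (mkℚ +0 d c) (mkℚ -[1+ x ] d′ c′) refl | _ , l = ⊥-elim (mid-not-below l)
word-injective (mkℚ +[1+ x ] d c) (mkℚ +0 d′ c′) eq with locate⁺ x d c
word-injective (mkℚ +[1+ x ] d c) (mkℚ +0 d′ c′) refl | _ , l = ⊥-elim (mid-not-below l)
word-injective (mkℚ -[1+ x ] d c) (mkℚ +0 d′ c′) eq with locate⁻ x d c
word-injective (mkℚ -[1+ x ] d c) (mkℚ +0 d′ c′) refl | _ , l = ⊥-elim (mid-not-below l)
word-injective (mkℚ +[1+ x ] d c) (mkℚ +[1+ x′ ] d′ c′) eq with locate⁺ x d c | locate⁺ x′ d′ c′
word-injective (mkℚ +[1+ x ] d c) (mkℚ +[1+ x′ ] d′ c′) refl | _ , l | _ , l′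
  with loc-unique l l′
... | refl , refl = refl
word-injective (mkℚ -[1+ x ] d c) (mkℚ -[1+ x′ ] d′ c′) eq with locate⁻ x d c | locate⁻ x′ d′ c′
word-injective (mkℚ -[1+ x ] d c) (mkℚ -[1+ x′ ] d′ c′) refl | _ , l | _ , l′
  with loc-unique l l′
... | refl , refl = refl
word-injective (mkℚ +[1+ x ] d c) (mkℚ -[1+ x′ ] d′ c′) eq with locate⁺ x d c | locate⁻ x′ d′ c′
word-injective (mkℚ +[1+ x ] d c) (mkℚ -[1+ x′ ] d′ c′) refl | _ , l | _ , l′ =
  ⊥-elim (halves-differ l l′)
word-injective (mkℚ -[1+ x ] d c) (mkℚ +[1+ x′ ] d′ c′) eq with locate⁻ x d c | locate⁺ x′ d′ c′
word-injective (mkℚ -[1+ x ] d c) (mkℚ +[1+ x′ ] d′ c′) refl | _ , l | _ , l′ =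
  ⊥-elim (halves-differ l′ l)

product-one : ∀ x d → suc x * suc d ≡ 1 → x ≡ 0 × d ≡ 0
product-one x d eq = ℕₚ.suc-injective (ℕₚ.m*n≡1⇒m≡1 (suc x) (suc d) eq)
                   , ℕₚ.suc-injective (ℕₚ.m*n≡1⇒n≡1 (suc x) (suc d) eq)

∞-adjacent : ∀ q → FareyAdj nothing (just q) → ℚ.denominator-1 q ≡ 0
∞-adjacent (mkℚ n d c) e = ℕₚ.suc-injective (trans (sym eq) e)
  where
  eq : ∣ (+ 1) ℤ.* +[1+ d ] ℤ.- n ℤ.* (+ 0) ∣ ≡ suc d
  eq = trans (cong (λ z → ∣ (+ 1) ℤ.* +[1+ d ] ℤ.- z ∣) (ℤₚ.*-zeroʳ n))
         (trans (cong ∣_∣ (ℤₚ.+-identityʳ ((+ 1) ℤ.* +[1+ d ]))) (cong suc (ℕₚ.+-identityʳ d)))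

∞-interval : ∀ q → FareyAdj nothing (just q) → Interval nothing (just (word q))
∞-interval q@(mkℚ n d c) e with ∞-adjacent q e
∞-interval (mkℚ +0       d c) e | refl = true ∷ [] , inj₂ (refl , refl)
∞-interval (mkℚ +[1+ x ] d c) e | refl with locate⁺ x 0 c
... | ρ , l with at-right-end l
...   | τ , h = τ , inj₂ h
∞-interval (mkℚ -[1+ x ] d c) e | refl with locate⁻ x 0 c
... | ρ , l with at-left-end l
...   | τ , h = τ , inj₁ h

0-interval : ∀ p q → ℚ.numerator p ≡ +0 → FareyAdj (just p) (just q) →
  Interval (just []) (just (word q))
0-interval (mkℚ +0 d c) (mkℚ +0 d′ c′) refl ()
0-interval (mkℚ +0 d c) (mkℚ +[1+ x ] d′ c′) refl e with product-one x d e
... | refl , _ with locate⁺ 0 d′ c′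
...   | ρ , l with at-left-end l
...     | τ , h = τ , inj₁ h
0-interval (mkℚ +0 d c) (mkℚ -[1+ x ] d′ c′) refl e with product-one x d e
... | refl , _ with locate⁻ 0 d′ c′
...   | ρ , l with at-right-end l
...     | τ , h = τ , inj₂ h

word-adjacent : ∀ p q → FareyAdj (just p) (just q) → Interval (just (word p)) (just (word q))
word-adjacent p@(mkℚ +0 _ _) q e = 0-interval p q refl e
word-adjacent p q@(mkℚ +0 _ _) e =
  interval-sym (0-interval q p refl (~-sym Farey {just p} {just q} e))
word-adjacent (mkℚ +[1+ x ] d c) (mkℚ +[1+ x′ ] d′ c′) e
  with locate⁺ x d c | locate⁺ x′ d′ c′ | consecutive (suc x * suc d′) (suc x′ * suc d) e
... | _ , l | _ , l′ | inj₁ eq = loc-adjacent l l′ eq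
... | _ , l | _ , l′ | inj₂ eq = interval-sym (loc-adjacent l′ l eq)
word-adjacent (mkℚ -[1+ x ] d c) (mkℚ -[1+ x′ ] d′ c′) e
  with locate⁻ x d c | locate⁻ x′ d′ c′ | consecutive (suc x′ * suc d) (suc x * suc d′) e
... | _ , l | _ , l′ | inj₁ eq = loc-adjacent l l′
        (trans (ℕₚ.*-comm (suc d) (suc x′)) (trans eq (cong suc (ℕₚ.*-comm (suc x) (suc d′)))))
... | _ , l | _ , l′ | inj₂ eq = interval-sym (loc-adjacent l′ l
        (trans (ℕₚ.*-comm (suc d′) (suc x)) (trans eq (cong suc (ℕₚ.*-comm (suc x′) (suc d))))))
-- For opposite signs the determinant is a sum of two positive products.
word-adjacent (mkℚ +[1+ x ] d c) (mkℚ -[1+ x′ ] d′ c′) e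
  with ℕₚ.m+n≡0⇒n≡0 (d′ + x * suc d′) (ℕₚ.suc-injective e)
... | ()
word-adjacent (mkℚ -[1+ x ] d c) (mkℚ +[1+ x′ ] d′ c′) ()

farey-coding : FareyCoding
farey-coding = record
  { code           = code
  ; code-injective = λ {p} {q} → injective p q
  ; code-adjacent  = λ {p} {q} → adjacent p q
  }
  where
  code : Maybe ℚ → Maybe Word
  code nothing  = nothing
  code (just q) = just (word q)
  injective : ∀ p q → code p ≡ code q → p ≡ q
  injective nothing  nothing  _  = refl
  injective (just p) (just q) eq = cong just (word-injective p q (Maybeₚ.just-injective eq))
  adjacent : ∀ p q → FareyAdj p q → Interval (code p) (code q)
  adjacent nothing  nothing  ()
  adjacent nothing  (just q) e = ∞-interval q e
  adjacent (just p) nothing  e = interval-sym (∞-interval p (~-sym Farey {just p} {nothing} e))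
  adjacent (just p) (just q) e = word-adjacent p q e

-- Both graphs are infinitely edge-connected

total : {A : Set} → (A → ℕ) → List A → ℕ
total f []      = 0
total f (x ∷ L) = f x + total f L

≤-total : ∀ {A : Set} (f : A → ℕ) {x L} → x ∈ₗ L → f x ℕ.≤ total f L
≤-total f {L = y ∷ L} (here refl) = ℕₚ.m≤m+n (f y) (total f L)
≤-total f {L = y ∷ L} (there i)   = ℕₚ.≤-trans (≤-total f i) (ℕₚ.m≤n+m (total f L) (f y))

Avoiding : (G : Graph) → List (V G × V G) → V G → V G → Set
Avoiding G F = Walk G (λ _ → ⊤) (λ x y → ¬ EdgeIn x y F)

turn-back : ∀ {G F x y} → Avoiding G F x y → Avoiding G F y x
turn-back = reverse (λ n → n ∘ edge-swap)

first-letter : Maybe (List ℕ) → ℕ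
first-letter (just (n ∷ _)) = n
first-letter _              = 0

T-ℵ₀*t-connected : InfEdgeConnected T-ℵ₀*t
T-ℵ₀*t-connected = (nothing , just [] , λ ()) , λ F u v _ → to-apex F u ▷ turn-back (to-apex F v)
  where
  to-apex : ∀ F x → Avoiding T-ℵ₀*t F x nothing
  to-apex F nothing  = stay tt
  to-apex F (just σ) = step tt (tree (down n σ)) (fresh ∘ edge-end ∘ edge-swap)
                        (step tt (apexʳ (n ∷ σ)) (fresh ∘ edge-end) (stay tt))
    where
    n : ℕ
    -- Larger than every first letter in `F`, so that `n ∷ σ` is an end of no forbidden edge.
    n = suc (total first-letter (ends F))
    fresh : just (n ∷ σ) ∉ₗ ends F
    fresh i = ℕₚ.<-irrefl refl (≤-total first-letter i)

record IsPoint (P : Maybe ℚ) (x y : ℕ) : Set where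
  constructor point
  field
    num≡ : num P ≡ + x
    den≡ : den P ≡ + y

size : Maybe ℚ → ℕ
size P = ∣ num P ∣ + ∣ den P ∣

size-point : ∀ {P x y} → IsPoint P x y → size P ≡ x + y
size-point (point n d) = cong₂ _+_ (cong ∣_∣ n) (cong ∣_∣ d)

abs-consecutive : ∀ {i j a b} → i ≡ + a → j ≡ + b → b ≡ suc a → ∣ i ℤ.- j ∣ ≡ 1
abs-consecutive {a = a} refl refl refl = trans (cong ∣_∣ (ℤₚ.m-n≡m⊖n a (suc a))) (go a)
  where
  go : ∀ a → ∣ a ⊖ suc a ∣ ≡ 1
  go zero    = refl
  go (suc a) = trans (cong ∣_∣ (ℤₚ.[1+m]⊖[1+n]≡m⊖n a (suc a))) (go a)

mul-point : ∀ {i j a b} → i ≡ + a → j ≡ + b → i ℤ.* j ≡ + (a * b)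
mul-point {a = a} {b} refl refl = sym (ℤₚ.pos-* a b)

point-adjacent : ∀ {P Q x y x′ y′} → IsPoint P x y → IsPoint Q x′ y′ →
  x′ * y ≡ suc (x * y′) → FareyAdj P Q
point-adjacent (point n d) (point n′ d′) eq =
  abs-consecutive (mul-point n d′) (mul-point n′ d) eq

-- The mediant and the left end again have determinant 1; this Bézout identity shows that the
-- fraction is in lowest terms.
mediant : ∀ {xL yL xR yR} → xR * yL ≡ suc (xL * yR) → ∃ λ M → IsPoint M (xL + xR) (yL + yR)
mediant {xL} {zero}  {xR} {yR} eq with trans (sym (ℕₚ.*-zeroʳ xR)) eq
... | ()
mediant {xL} {suc y} {xR} {yR} eq = just (mkℚ (+ (xL + xR)) (y + yR) cop) , point refl refl
  where
  open +-*-Solver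
  bezout : xL * (suc y + yR) + 1 ≡ (xL + xR) * suc y
  bezout = trans (solve 3 (λ a b c → a :* (b :+ c) :+ con 1 := a :* b :+ (con 1 :+ a :* c)) refl xL (suc y) yR)
             (trans (cong (_+_ (xL * suc y)) (sym eq)) (sym (ℕₚ.*-distribʳ-+ (suc y) xL xR)))
  cop : Coprime (xL + xR) (suc (y + yR))
  cop {d} (d∣x , d∣y) = ∣1⇒≡1
    (∣m+n∣m⇒∣n (subst (d ∣_) (sym bezout) (∣m⇒∣m*n (suc y) d∣x)) (∣n⇒∣m*n xL d∣y))

module Subdividing (F : List (Maybe ℚ × Maybe ℚ)) where

  bound : ℕ
  bound = total size (ends F)

  bound-edge : ∀ {P Q} → EdgeIn P Q F → size P + size Q ℕ.≤ bound + bound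
  bound-edge e = ℕₚ.+-mono-≤ (≤-total size (edge-end e)) (≤-total size (edge-end (edge-swap e)))

  -- Only finitely many edges are forbidden, and subdividing increases the size of the ends.
  along : ∀ n {P Q xL yL xR yR} → IsPoint P xL yL → IsPoint Q xR yR → xR * yL ≡ suc (xL * yR) →
    bound + bound ℕ.< n + ((xL + yL) + (xR + yR)) → Avoiding Farey F P Q
  along zero {P} {Q} p q eq big = step tt (point-adjacent p q eq)
    (λ e → ℕₚ.<-irrefl refl (ℕₚ.<-≤-trans
      (subst (bound + bound ℕ.<_) (sym (cong₂ _+_ (size-point p) (size-point q))) big) (bound-edge e)))
    (stay tt)
  along (suc n) {P} {Q} {xL} {zero} {xR} {yR} p q eq big with trans (sym (ℕₚ.*-zeroʳ xR)) eq
  ... | ()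
  along (suc n) {P} {Q} {xL} {suc y} {zero} {yR} p q () big
  along (suc n) {P} {Q} {xL} {suc y} {suc x} {yR} p q eq big with mediant {xL} {suc y} {suc x} {yR} eq
  ... | M , m =
      along n p m
        (trans (ℕₚ.*-distribʳ-+ (suc y) xL (suc x)) (trans (cong (_+_ (xL * suc y)) eq)
          (solve 3 (λ a b c → a :* b :+ (con 1 :+ a :* c) := con 1 :+ a :* (b :+ c)) refl xL (suc y) yR)))
        -- The total size grows by `xL + suc y`, of which 1 pays for the unit of fuel and `xL + y`
        -- is left over.
        (ℕₚ.<-≤-trans big (grow (xL + y)
          (solve 5 (λ n a b c d →
            (con 1 :+ n :+ ((a :+ (con 1 :+ b)) :+ ((con 1 :+ c) :+ d))) :+ (a :+ b) :=
            n :+ ((a :+ (con 1 :+ b)) :+ ((a :+ (con 1 :+ c)) :+ ((con 1 :+ b) :+ d)))) refl n xL y x yR)))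
    ▷ along n m q
        (trans (ℕₚ.*-distribˡ-+ (suc x) (suc y) yR) (trans (cong (_+ suc x * yR) eq)
          (cong suc (sym (ℕₚ.*-distribʳ-+ yR xL (suc x))))))
        (ℕₚ.<-≤-trans big (grow (x + yR)
          (solve 5 (λ n a b c d →
            (con 1 :+ n :+ ((a :+ (con 1 :+ b)) :+ ((con 1 :+ c) :+ d))) :+ (c :+ d) :=
            n :+ (((a :+ (con 1 :+ c)) :+ ((con 1 :+ b) :+ d)) :+ ((con 1 :+ c) :+ d))) refl n xL y x yR)))
    where
    open +-*-Solver
    grow : ∀ {a b} c → a + c ≡ b → a ℕ.≤ b
    grow {a} c eq′ = subst (a ℕ.≤_) eq′ (ℕₚ.m≤m+n a c)

  along′ : ∀ {P Q xL yL xR yR} → IsPoint P xL yL → IsPoint Q xR yR → xR * yL ≡ suc (xL * yR) →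
    Avoiding Farey F P Q
  along′ {xL = xL} {yL} {xR} {yR} p q eq = along (suc (bound + bound)) p q eq (ℕₚ.m≤m+n _ _)

  -- Follows the Euclidean run to `P`. A `right` step replaces the left end by the mediant, which is
  -- joined back to the old left end by subdivision.
  reach-end : ∀ {σ v u ρ L R P xL yL xR yR} → Loc σ v u ρ →
    IsPoint L xL yL → IsPoint R xR yR → xR * yL ≡ suc (xL * yR) →
    IsPoint P (v * xL + u * xR) (v * yL + u * yR) → Avoiding Farey F P L
  reach-end {L = L} {P = P} {xL = xL} {yL} {xR} {yR} mid l r eq p = turn-back (along′ l
    (subst₂ (IsPoint P) (one xL xR) (one yL yR) p)
    (trans (ℕₚ.*-distribʳ-+ yL xL xR) (trans (cong (_+_ (xL * yL)) eq)
      (trans (ℕₚ.+-suc (xL * yL) (xL * yR)) (cong suc (sym (ℕₚ.*-distribˡ-+ xL yL yR)))))))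
    where
    one : ∀ a b → 1 * a + 1 * b ≡ a + b
    one a b = cong₂ _+_ (ℕₚ.*-identityˡ a) (ℕₚ.*-identityˡ b)
  reach-end {P = P} {xL} {yL} {xR} {yR} (right {v} {u} loc) l r eq p with mediant {xL} {yL} {xR} {yR} eq
  ... | M , m = reach-end loc m r
      (trans (ℕₚ.*-distribˡ-+ xR yL yR) (trans (cong (_+ xR * yR) eq)
        (cong suc (sym (ℕₚ.*-distribʳ-+ yR xL xR)))))
      (subst₂ (IsPoint P) (shift xL xR) (shift yL yR) p)
    ▷ turn-back (along′ l m
      (trans (ℕₚ.*-distribʳ-+ yL xL xR) (trans (cong (_+_ (xL * yL)) eq)
        (trans (ℕₚ.+-suc (xL * yL) (xL * yR)) (cong suc (sym (ℕₚ.*-distribˡ-+ xL yL yR)))))))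
    where
    open +-*-Solver
    shift : ∀ a b → v * a + (v + u) * b ≡ v * (a + b) + u * b
    shift = solve 4 (λ v u a b → v :* a :+ (v :+ u) :* b := v :* (a :+ b) :+ u :* b) refl v u
  reach-end {P = P} {xL} {yL} {xR} {yR} (left {v} {u} loc) l r eq p with mediant {xL} {yL} {xR} {yR} eq
  ... | M , m = reach-end loc l m
      (trans (ℕₚ.*-distribʳ-+ yL xL xR) (trans (cong (_+_ (xL * yL)) eq)
        (trans (ℕₚ.+-suc (xL * yL) (xL * yR)) (cong suc (sym (ℕₚ.*-distribˡ-+ xL yL yR))))))
      (subst₂ (IsPoint P) (shift xL xR) (shift yL yR) p)
    where
    open +-*-Solver
    shift : ∀ a b → (u + v) * a + u * b ≡ v * a + u * (a + b)
    shift = solve 4 (λ v u a b → (u :+ v) :* a :+ u :* b := v :* a :+ u :* (a :+ b)) refl v u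

  zero-point : IsPoint (just ℚ.0ℚ) 0 1
  zero-point = point refl refl

  ∞-point : IsPoint nothing 1 0
  ∞-point = point refl refl

  0-∞ : Avoiding Farey F (just ℚ.0ℚ) nothing
  0-∞ = along′ zero-point ∞-point refl

  nonneg : ∀ q n → ℚ.numerator q ≡ + n → Avoiding Farey F (just q) nothing
  nonneg (mkℚ _ d c) zero refl with zero-den d c
  ... | refl = 0-∞
  nonneg (mkℚ _ d c) (suc x) refl = reach-end (proj₂ (locate⁺ x d c)) zero-point ∞-point refl
      (point (cong +_ (ns (suc d) (suc x))) (cong +_ (ds (suc d) (suc x))))
    ▷ 0-∞
    where
    open +-*-Solver
    ns : ∀ v u → u ≡ v * 0 + u * 1
    ns = solve 2 (λ v u → u := v :* con 0 :+ u :* con 1) refl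
    ds : ∀ v u → v ≡ v * 1 + u * 0
    ds = solve 2 (λ v u → v := v :* con 1 :+ u :* con 0) refl

-- The reflection is an automorphism of the Farey graph and carries connectivity over to the
-- negative rationals.
mirror : Maybe ℚ → Maybe ℚ
mirror = Maybe.map (λ q → ℚ.- q)

mirror-involutive : ∀ P → mirror (mirror P) ≡ P
mirror-involutive nothing                     = refl
mirror-involutive (just (mkℚ +0 d c))       = refl
mirror-involutive (just (mkℚ +[1+ x ] d c)) = refl
mirror-involutive (just (mkℚ -[1+ x ] d c)) = refl

mirror-adjacent : ∀ P Q → FareyAdj P Q → FareyAdj (mirror P) (mirror Q)
mirror-adjacent nothing  nothing  ()
mirror-adjacent (just p) nothing  e =
  ~-sym Farey {nothing} {just (ℚ.- p)} (mirror-adjacent nothing (just p) (~-sym Farey {just p} {nothing} e))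
mirror-adjacent nothing  (just q) e =
  trans (cong ∣_∣ (cong₂ ℤ._-_ (cong ((+ 1) ℤ.*_) (ℚₚ.↧-neg q))
    (trans (ℤₚ.*-zeroʳ (ℚ.↥ (ℚ.- q))) (sym (ℤₚ.*-zeroʳ (ℚ.↥ q)))))) e
mirror-adjacent (just p) (just q) e =
  trans (cong ∣_∣ (trans (cong₂ ℤ._-_ (neg-product p q) (neg-product q p))
      (sym (ℤₚ.neg-distrib-+ (ℚ.↥ p ℤ.* ℚ.↧ q) (ℤ.- (ℚ.↥ q ℤ.* ℚ.↧ p))))))
    (trans (ℤₚ.∣-i∣≡∣i∣ (ℚ.↥ p ℤ.* ℚ.↧ q ℤ.- ℚ.↥ q ℤ.* ℚ.↧ p)) e)
  where
  neg-product : ∀ p q → ℚ.↥ (ℚ.- p) ℤ.* ℚ.↧ (ℚ.- q) ≡ ℤ.- (ℚ.↥ p ℤ.* ℚ.↧ q)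
  neg-product p q = trans (cong₂ ℤ._*_ (ℚₚ.↥-neg p) (ℚₚ.↧-neg q))
    (sym (ℤₚ.neg-distribˡ-* (ℚ.↥ p) (ℚ.↧ q)))

mirror-edges : List (Maybe ℚ × Maybe ℚ) → List (Maybe ℚ × Maybe ℚ)
mirror-edges = map λ (P , Q) → mirror P , mirror Q

mirror-edge : ∀ {P Q F} → EdgeIn P Q F → EdgeIn (mirror P) (mirror Q) (mirror-edges F)
mirror-edge here-xy   = here-xy
mirror-edge here-yx   = here-yx
mirror-edge (there e) = there (mirror-edge e)

mirror-walk : ∀ {F P Q} → Avoiding Farey (mirror-edges F) P Q → Avoiding Farey F (mirror P) (mirror Q)
mirror-walk (stay _) = stay tt
mirror-walk {F} (step {x = P} {y = Q} _ e n w) = step tt (mirror-adjacent P Q e)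
  (λ i → n (subst₂ (λ a b → EdgeIn a b (mirror-edges F)) (mirror-involutive P) (mirror-involutive Q)
    (mirror-edge i)))
  (mirror-walk w)

Farey-connected : InfEdgeConnected Farey
Farey-connected = (nothing , just ℚ.0ℚ , λ ()) , λ F P Q _ → to-∞ F P ▷ turn-back (to-∞ F Q)
  where
  to-∞ : ∀ F P → Avoiding Farey F P nothing
  to-∞ F nothing                   = stay tt
  to-∞ F (just q@(mkℚ (+ n) _ _))  = Subdividing.nonneg F q n refl
  to-∞ F (just (mkℚ -[1+ x ] d c)) = mirror-walk
    (Subdividing.nonneg (mirror-edges F) (mkℚ +[1+ x ] d c) (suc x) refl)

-- The Farey graph is no minor of T-ℵ₀*t

Connected : (G : Graph) → (V G → Set) → Set
Connected G S = ∀ {x y} → S x → S y → Walk G S (λ _ _ → ⊤) x y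

widen : ∀ {G} {S S′ : V G → Set} → (∀ {x} → S x → S′ x) →
  ∀ {x y} → Walk G S (λ _ _ → ⊤) x y → Walk G S′ (λ _ _ → ⊤) x y
widen i (stay h)       = stay (i h)
widen i (step h e _ w) = step (i h) e tt (widen i w)

module Crossing (em : ExcludedMiddle 0ℓ) where

  cross : ∀ {G S OK x y} (P : V G → Set) → Walk G S OK x y → P x → ¬ P y →
    ∃ λ a → ∃ λ b → S a × S b × P a × ¬ P b × _~_ G a b
  cross P (stay _) p ¬p = ⊥-elim (¬p p)
  cross P (step {y = y} h e _ w) p ¬p with em {P y}
  ... | yes q = cross P w q ¬p
  ... | no ¬q = _ , y , h , start w , p , ¬q , e

  module NoTriangle where

    Below : List ℕ → Maybe (List ℕ) → Set
    Below σ nothing  = ⊥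
    Below σ (just τ) = σ ≡ τ ⊎ Above σ τ

    above-proper : ∀ {n : ℕ} {σ τ} → Below (n ∷ σ) (just τ) → Above σ τ
    above-proper (inj₁ refl)      = parent
    above-proper (inj₂ parent)    = later parent
    above-proper (inj₂ (later a)) = later (above-proper (inj₂ a))

    parent-outside : ∀ {n σ} → ¬ Below (n ∷ σ) (just σ)
    parent-outside b = ℕₚ.<-irrefl refl (above-length (above-proper b))

    exit-edge : ∀ {n σ a b} → TtAdj a b → Below (n ∷ σ) a → ¬ Below (n ∷ σ) b → b ≢ nothing →
      a ≡ just (n ∷ σ) × b ≡ just σ
    exit-edge (tree (down k τ)) (inj₁ refl)      ¬b _ = ⊥-elim (¬b (inj₂ parent))
    exit-edge (tree (down k τ)) (inj₂ a)         ¬b _ = ⊥-elim (¬b (inj₂ (later a)))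
    exit-edge (tree (up k τ))   (inj₁ refl)      ¬b _ = refl , refl
    exit-edge (tree (up k τ))   (inj₂ parent)    ¬b _ = ⊥-elim (¬b (inj₁ refl))
    exit-edge (tree (up k τ))   (inj₂ (later a)) ¬b _ = ⊥-elim (¬b (inj₂ a))
    exit-edge (apexʳ _)         _                _  n = ⊥-elim (n refl)

    exit-walk : ∀ {n σ S x y} → Connected T-ℵ₀*t S → ¬ S nothing → S x → S y →
      Below (n ∷ σ) x → ¬ Below (n ∷ σ) y → S (just (n ∷ σ)) × S (just σ)
    exit-walk {n} {σ} {S} cn ¬t x∈ y∈ b ¬b with cross (Below (n ∷ σ)) (cn x∈ y∈) b ¬b
    ... | a , a′ , a∈ , a′∈ , p , ¬p , e
      with exit-edge e p ¬p (λ eq → ¬t (subst S eq a′∈))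
    ...   | refl , refl = a∈ , a′∈

    Joined : (A B : Maybe (List ℕ) → Set) → Set
    Joined A B = ∃ λ x → ∃ λ y → A x × B y × TtAdj x y

    no-triangle : ∀ {A B C} → Connected T-ℵ₀*t A → Connected T-ℵ₀*t B → Connected T-ℵ₀*t C →
      ¬ A nothing → ¬ B nothing → ¬ C nothing →
      (∀ {x} → A x → ¬ B x) → (∀ {x} → A x → ¬ C x) → (∀ {x} → B x → ¬ C x) →
      Joined A B → Joined A C → Joined B C → ⊥
    no-triangle {A} {B} {C} cA cB cC ¬A ¬B ¬C AB AC BC (x , y , x∈ , y∈ , e) ac bc = from e x∈ y∈
      where
      -- The edge from A to B cuts the tree in two, and C lies on one side.
      core : ∀ {A B n σ} → Connected T-ℵ₀*t A → Connected T-ℵ₀*t B → ¬ A nothing → ¬ B nothing →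
        (∀ {x} → A x → ¬ B x) → (∀ {x} → A x → ¬ C x) → (∀ {x} → B x → ¬ C x) →
        A (just σ) → B (just (n ∷ σ)) → Joined A C → Joined B C → ⊥
      core {A} {B} {n} {σ} cA cB ¬A ¬B AB AC BC a∈ b∈ (a , c , a′∈ , c∈ , ac) (b , c′ , b′∈ , c′∈ , bc)
        with em {Below (n ∷ σ) c}
      -- Here `c` lies below the cut. The set `A` or its edge to `c` crosses the cut, and each way
      -- puts `n ∷ σ` into a set disjoint from `B`.
      ... | yes in-c with em {Below (n ∷ σ) a}
      ...   | yes in-a = AB (proj₁ (exit-walk cA ¬A a′∈ a∈ in-a parent-outside)) b∈
      ...   | no out-a with exit-edge (~-sym T-ℵ₀*t ac) in-c out-a (λ eq → ¬A (subst A eq a′∈))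
      ...     | refl , _ = BC b∈ c∈
      core {A} {B} {n} {σ} cA cB ¬A ¬B AB AC BC a∈ b∈ (a , c , a′∈ , c∈ , ac) (b , c′ , b′∈ , c′∈ , bc)
        | no out-c with em {Below (n ∷ σ) b} | em {Below (n ∷ σ) c′}
      -- Now `c` lies above the cut, which is crossed inside `B`, inside `C`, or by the edge between
      -- them.
      ... | no out-b | _ = AB a∈ (proj₂ (exit-walk cB ¬B b∈ b′∈ (inj₁ refl) out-b))
      ... | yes _ | yes in-c′ = BC b∈ (proj₁ (exit-walk cC ¬C c′∈ c∈ in-c′ out-c))
      ... | yes in-b | no out-c′ with exit-edge bc in-b out-c′ (λ eq → ¬C (subst C eq c′∈))
      ...   | _ , refl = AC a∈ c′∈
      from : ∀ {x y} → TtAdj x y → A x → B y → ⊥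
      from (tree (down n σ)) x∈ y∈ = core cA cB ¬A ¬B AB AC BC x∈ y∈ ac bc
      from (tree (up n σ))   x∈ y∈ = core cB cA ¬B ¬A (λ b a → AB a b) BC AC y∈ x∈ bc ac
      from (apexˡ _)         x∈ _  = ¬A x∈
      from (apexʳ _)         _  y∈ = ¬B y∈

  module _ (M : Farey ≼ T-ℵ₀*t) where
    open _≼_ M
    open NoTriangle

    apex-in-triangle : ∀ {p q r} → FareyAdj p q → FareyAdj p r → FareyAdj q r →
      p ≢ q → p ≢ r → q ≢ r → branch p nothing ⊎ branch q nothing ⊎ branch r nothing
    apex-in-triangle {p} {q} {r} pq pr qr p≢q p≢r q≢r
      with em {branch p nothing} | em {branch q nothing} | em {branch r nothing}
    ... | yes i | _     | _     = inj₁ i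
    ... | no _  | yes i | _     = inj₂ (inj₁ i)
    ... | no _  | no _  | yes i = inj₂ (inj₂ i)
    ... | no i  | no j  | no k  = ⊥-elim (no-triangle (connected p) (connected q) (connected r)
      i j k (λ x y → p≢q (disjoint x y)) (λ x y → p≢r (disjoint x y)) (λ x y → q≢r (disjoint x y))
      (edges {p} {q} pq) (edges {p} {r} pr) (edges {q} {r} qr))

    Farey⋠T-ℵ₀*t : ⊥
    Farey⋠T-ℵ₀*t = clash
      -- The triangles on ∞, 0, 1 and on 2, 5/2, 3 are disjoint, yet each would have a branch set
      -- containing the apex.
      (apex-in-triangle {nothing} {just 0ℚ} {just 1ℚ} refl refl refl (λ ()) (λ ()) (λ ()))
      (apex-in-triangle {just 2ℚ} {just 5/2} {just 3ℚ} refl refl refl (λ ()) (λ ()) (λ ()))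
      where
      open import Data.Rational using (0ℚ; 1ℚ; _/_)
      2ℚ 3ℚ 5/2 : ℚ
      2ℚ  = + 2 / 1
      3ℚ  = + 3 / 1
      5/2 = + 5 / 2
      clash : branch nothing nothing ⊎ branch (just 0ℚ) nothing ⊎ branch (just 1ℚ) nothing →
        branch (just 2ℚ) nothing ⊎ branch (just 5/2) nothing ⊎ branch (just 3ℚ) nothing → ⊥
      clash (inj₁ i)        (inj₁ j)        with () ← disjoint i j
      clash (inj₁ i)        (inj₂ (inj₁ j)) with () ← disjoint i j
      clash (inj₁ i)        (inj₂ (inj₂ j)) with () ← disjoint i j
      clash (inj₂ (inj₁ i)) (inj₁ j)        with () ← disjoint i j
      clash (inj₂ (inj₁ i)) (inj₂ (inj₁ j)) with () ← disjoint i j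
      clash (inj₂ (inj₁ i)) (inj₂ (inj₂ j)) with () ← disjoint i j
      clash (inj₂ (inj₂ i)) (inj₁ j)        with () ← disjoint i j
      clash (inj₂ (inj₂ i)) (inj₂ (inj₁ j)) with () ← disjoint i j
      clash (inj₂ (inj₂ i)) (inj₂ (inj₂ j)) with () ← disjoint i j

-- T-ℵ₀*t is no minor of the Farey graph

infix 4 _◁_
-- The circle cut open at ∞, which becomes the greatest element.
_◁_ : Maybe ℚ → Maybe ℚ → Set
_◁_ = _<⁺_

◁-trans : ∀ {P Q R} → P ◁ Q → Q ◁ R → P ◁ R
◁-trans = <⁺-trans ℚₚ.<-trans

◁-cmp : Trichotomous _≡_ _◁_
◁-cmp = <⁺-cmp-≡ ℚₚ.<-cmp

◁-irrefl : ∀ {P} → ¬ P ◁ P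
◁-irrefl = <⁺-irrefl-≡ ℚₚ.<-irrefl refl

◁-cross : ∀ {P Q} → P ◁ Q → num P ℤ.* den Q ℤ.< num Q ℤ.* den P
◁-cross [ ℚ.*<* h ]  = h
◁-cross [ mkℚ n d _ ]<⊤⁺ =
  subst₂ ℤ._<_ (sym (ℤₚ.*-zeroʳ n)) (sym (ℤₚ.*-identityˡ +[1+ d ])) (ℤ.+<+ (ℕ.s≤s ℕ.z≤n))

den-nonNeg : ∀ P → ℤ.NonNegative (den P)
den-nonNeg nothing            = _
den-nonNeg (just (mkℚ _ _ _)) = _

1≤difference : ∀ {i j} → i ℤ.< j → ℤ.1ℤ ℤ.≤ j ℤ.- i
1≤difference {i} {j} h = subst (ℤ._≤ j ℤ.- i)
  (solve 1 (λ i → con ℤ.1ℤ :+ i :- i := con ℤ.1ℤ) refl i)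
  (ℤₚ.+-monoˡ-≤ (ℤ.- i) (ℤₚ.i<j⇒suc[i]≤j h))
  where open ℤ-Solver.+-*-Solver

-- With P = a/b, Q = x/y, R = c/d and c b − a d = 1 one has y = b (c y − x d) + d (x b − a y).
den-between : ∀ {P Q R} → P ◁ Q → Q ◁ R → FareyAdj P R → den P ℤ.+ den R ℤ.≤ den Q
den-between {P} {Q} {R} pq qr adj = subst₂ ℤ._≤_
  (cong₂ ℤ._+_ (ℤₚ.*-identityʳ (den P)) (ℤₚ.*-identityʳ (den R))) identity
  (ℤₚ.+-mono-≤
    (ℤₚ.*-monoˡ-≤-nonNeg (den P) {{den-nonNeg P}} (1≤difference (◁-cross qr)))
    (ℤₚ.*-monoˡ-≤-nonNeg (den R) {{den-nonNeg R}} (1≤difference (◁-cross pq))))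
  where
  open ℤ-Solver.+-*-Solver
  det : num R ℤ.* den P ℤ.- num P ℤ.* den R ≡ ℤ.1ℤ
  det = trans (sym (ℤₚ.0≤i⇒+∣i∣≡i (ℤₚ.i≤j⇒0≤j-i (ℤₚ.<⇒≤ (◁-cross (◁-trans pq qr))))))
          (cong +_ (~-sym Farey {P} {R} adj))
  identity : den P ℤ.* (num R ℤ.* den Q ℤ.- num Q ℤ.* den R) ℤ.+
             den R ℤ.* (num Q ℤ.* den P ℤ.- num P ℤ.* den Q) ≡ den Q
  identity = trans
    (solve 6 (λ a b x y c d → b :* (c :* y :- x :* d) :+ d :* (x :* b :- a :* y) :=
                              y :* (c :* b :- a :* d))
      refl (num P) (den P) (num Q) (den Q) (num R) (den R))
    (trans (cong (den Q ℤ.*_) det) (ℤₚ.*-identityʳ (den Q)))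

-- Two uses of `den-between` give `den P + den R ≤ den Q` and `den Q + den S ≤ den R`, but `den P`
-- is positive.
chords-uncrossed : ∀ {P Q R S} → P ◁ Q → Q ◁ R → R ◁ S → FareyAdj P R → ¬ FareyAdj Q S
chords-uncrossed {P} {Q} {R} {S} pq qr rs pr qs =
  ℤₚ.<-irrefl refl (ℤₚ.<-≤-trans
    (subst (ℤ._< den P ℤ.+ den R) (ℤₚ.+-identityˡ (den R)) (ℤₚ.+-monoˡ-< (den R) (positive pq)))
    (ℤₚ.≤-trans (den-between {P} {Q} {R} pq qr pr)
      (ℤₚ.≤-trans (ℤₚ.i≤i+j (den Q) (den S) {{den-nonNeg S}}) (den-between {Q} {R} {S} qr rs qs))))
  where
  positive : ∀ {P Q} → P ◁ Q → ℤ.0ℤ ℤ.< den P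
  positive {just (mkℚ _ _ _)} _ = ℤ.+<+ (ℕ.s≤s ℕ.z≤n)

module Outerplanar (em : ExcludedMiddle 0ℓ) where
  open Crossing em

  Within : (P Q : Maybe ℚ) → Maybe ℚ → Set
  Within P Q Z = P ◁ Z × Z ◁ Q

  outside : ∀ {P Q Z} → ¬ Within P Q Z → Z ≢ P → Z ≢ Q → Z ◁ P ⊎ Q ◁ Z
  outside {P} {Q} {Z} n ≢P ≢Q with ◁-cmp Z P
  ... | tri< h _ _  = inj₁ h
  ... | tri≈ _ eq _ = ⊥-elim (≢P eq)
  ... | tri> _ _ h with ◁-cmp Z Q
  ...   | tri< k _ _  = ⊥-elim (n (h , k))
  ...   | tri≈ _ eq _ = ⊥-elim (≢Q eq)
  ...   | tri> _ _ k  = inj₂ k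

  -- To get from one side of the chord to the other while missing its ends, `Y` would need an edge
  -- that crosses it.
  no-chord : ∀ {Y P Q} → Connected Farey Y → ¬ Y P → ¬ Y Q → FareyAdj P Q →
    ∀ {y y′} → Y y → Y y′ → Within P Q y → ¬ Within P Q y′ → ⊥
  no-chord {Y} {P} {Q} cY ¬P ¬Q pq y∈ y′∈ in-y out-y′ with cross (Within P Q) (cY y∈ y′∈) in-y out-y′
  ... | s , t , s∈ , t∈ , (ps , sq) , out-t , st
    with outside out-t (λ eq → ¬P (subst Y eq t∈)) (λ eq → ¬Q (subst Y eq t∈))
  ...   | inj₁ tp = chords-uncrossed tp ps sq (~-sym Farey {s} {t} st) pq
  ...   | inj₂ qt = chords-uncrossed ps sq qt pq st

  -- Some edge of `X` leaves the arc between `y` and `y′`. It is a chord that separates these two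
  -- vertices of `Y`.
  no-alternation : ∀ {X Y} → Connected Farey X → Connected Farey Y → (∀ {z} → X z → ¬ Y z) →
    ∀ {x y x′ y′} → X x → Y y → X x′ → Y y′ → x ◁ y → y ◁ x′ → x′ ◁ y′ → ⊥
  no-alternation {X} {Y} cX cY XY x∈ y∈ x′∈ y′∈ xy yx′ x′y′
    with cross (Within _ _) (cX x′∈ x∈) (yx′ , x′y′) (λ (yx , _) → ◁-irrefl (◁-trans xy yx))
  ... | p , q , p∈ , q∈ , (yp , py′) , out-q , pq
    with outside out-q (λ eq → XY q∈ (subst Y (sym eq) y∈)) (λ eq → XY q∈ (subst Y (sym eq) y′∈))
  ...   | inj₁ qy = no-chord cY (XY q∈) (XY p∈) (~-sym Farey {p} {q} pq) y∈ y′∈ (qy , yp)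
                      (λ (_ , y′p) → ◁-irrefl (◁-trans py′ y′p))
  ...   | inj₂ y′q = no-chord cY (XY p∈) (XY q∈) pq y′∈ y∈ (py′ , y′q)
                      (λ (py , _) → ◁-irrefl (◁-trans yp py))

  module _ (M : T-ℵ₀*t ≼ Farey) where
    open _≼_ M

    leaf : ℕ → Maybe (List ℕ)
    leaf i = just (i ∷ [])

    record Hub (h : Maybe (List ℕ)) : Set where
      field
        spoke : ∀ i → TtAdj h (leaf i)
        ≢leaf : ∀ {i} → h ≢ leaf i

    -- One edge of K₂,₃ turned into a connected set. Arms that differ both in hub and in leaf are
    -- disjoint, so they cannot alternate.
    Arm : Maybe (List ℕ) → ℕ → Maybe ℚ → Set
    Arm h i x = branch h x ⊎ branch (leaf i) x

    arm-connected : ∀ {h} → Hub h → ∀ i → Connected Farey (Arm h i)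
    arm-connected {h} H i x∈ y∈ with edges (Hub.spoke H i)
    ... | p , q , p∈ , q∈ , e = reverse id (to x∈) ▷ to y∈
      where
      to : ∀ {y} → Arm h i y → Walk Farey (Arm h i) (λ _ _ → ⊤) p y
      to (inj₁ y∈) = widen inj₁ (connected h p∈ y∈)
      to (inj₂ y∈) = step (inj₁ p∈) e tt (widen inj₂ (connected (leaf i) q∈ y∈))

    leaf-injective : ∀ {i j} → leaf i ≡ leaf j → i ≡ j
    leaf-injective refl = refl

    arms-disjoint : ∀ {h h′ i j} → Hub h → Hub h′ → h ≢ h′ → i ≢ j → ∀ {z} → Arm h i z → ¬ Arm h′ j z
    arms-disjoint H H′ h≢ i≢ (inj₁ p) (inj₁ q) = h≢ (disjoint p q)
    arms-disjoint H H′ h≢ i≢ (inj₁ p) (inj₂ q) = Hub.≢leaf H (disjoint p q)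
    arms-disjoint H H′ h≢ i≢ (inj₂ p) (inj₁ q) = Hub.≢leaf H′ (disjoint q p)
    arms-disjoint H H′ h≢ i≢ (inj₂ p) (inj₂ q) = i≢ (leaf-injective (disjoint p q))

    c : ℕ → Maybe ℚ
    c i = proj₁ (nonempty (leaf i))

    c∈ : ∀ i → branch (leaf i) (c i)
    c∈ i = proj₂ (nonempty (leaf i))

    clash : ∀ {h h′ i j} → Hub h → Hub h′ → h ≢ h′ → i ≢ j →
      ∀ {x y x′ y′} → Arm h i x → Arm h′ j y → Arm h i x′ → Arm h′ j y′ →
      x ◁ y → y ◁ x′ → x′ ◁ y′ → ⊥
    clash {i = i} {j} H H′ h≢ i≢ = no-alternation (arm-connected H i) (arm-connected H′ j)
      (arms-disjoint H H′ h≢ i≢)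

    -- Wherever `a` and `b` fall among the three leaves, two disjoint arms alternate.
    no-K₂₃-sorted : ∀ {h h′ i j k a b} → Hub h → Hub h′ → h ≢ h′ → i ≢ j → i ≢ k → j ≢ k →
      branch h a → branch h′ b → c i ◁ c j → c j ◁ c k → a ◁ b → ⊥
    no-K₂₃-sorted {h} {h′} {i} {j} {k} {a} {b} H H′ h≢ i≢j i≢k j≢k a∈ b∈ ij jk ab with ◁-cmp a (c j)
    ... | tri≈ _ refl _ = Hub.≢leaf H (disjoint a∈ (c∈ j))
    ... | tri> _ _ ja = clash H H′ h≢ i≢j (inj₂ (c∈ i)) (inj₂ (c∈ j)) (inj₁ a∈) (inj₁ b∈) ij ja ab
    ... | tri< aj _ _ with ◁-cmp b (c j)
    ...   | tri≈ _ refl _ = Hub.≢leaf H′ (disjoint b∈ (c∈ j))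
    ...   | tri< bj _ _ = clash H H′ h≢ j≢k (inj₁ a∈) (inj₁ b∈) (inj₂ (c∈ j)) (inj₂ (c∈ k)) ab bj jk
    ...   | tri> _ _ jb with ◁-cmp a (c i) | ◁-cmp b (c k)
    ...     | tri≈ _ refl _ | _ = Hub.≢leaf H (disjoint a∈ (c∈ i))
    ...     | _ | tri≈ _ refl _ = Hub.≢leaf H′ (disjoint b∈ (c∈ k))
    ...     | tri< ai _ _ | _ =
      clash H H′ h≢ (i≢j ∘ sym) (inj₁ a∈) (inj₂ (c∈ i)) (inj₂ (c∈ j)) (inj₁ b∈) ai ij jb
    ...     | tri> _ _ _ | tri> _ _ kb =
      clash H H′ h≢ (j≢k ∘ sym) (inj₁ a∈) (inj₂ (c∈ j)) (inj₂ (c∈ k)) (inj₁ b∈) aj jk kb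
    ...     | tri> _ _ ia | tri< bk _ _ =
      clash H′ H (h≢ ∘ sym) i≢k (inj₂ (c∈ i)) (inj₁ a∈) (inj₁ b∈) (inj₂ (c∈ k)) ia ab bk

    apex-hub : Hub nothing
    apex-hub = record { spoke = λ i → apexˡ (i ∷ []) ; ≢leaf = λ () }

    root-hub : Hub (just [])
    root-hub = record { spoke = λ i → tree (down i []) ; ≢leaf = λ () }

    sorted-absurd : ∀ {i j k} → i ≢ j → i ≢ k → j ≢ k → c i ◁ c j → c j ◁ c k → ⊥
    sorted-absurd i≢j i≢k j≢k ij jk with nonempty nothing | nonempty (just [])
    ... | a , a∈ | b , b∈ with ◁-cmp a b
    ...   | tri< ab _ _ =
      no-K₂₃-sorted apex-hub root-hub (λ ()) i≢j i≢k j≢k a∈ b∈ ij jk ab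
    ...   | tri> _ _ ba =
      no-K₂₃-sorted root-hub apex-hub (λ ()) i≢j i≢k j≢k b∈ a∈ ij jk ba
    ...   | tri≈ _ refl _ with () ← disjoint a∈ b∈

    c-distinct : ∀ {i j} → i ≢ j → c i ≢ c j
    c-distinct {i} {j} i≢j eq =
      i≢j (leaf-injective (disjoint (c∈ i) (subst (branch (leaf j)) (sym eq) (c∈ j))))

    T-ℵ₀*t⋠Farey : ⊥
    T-ℵ₀*t⋠Farey with ◁-cmp (c 0) (c 1) | ◁-cmp (c 1) (c 2) | ◁-cmp (c 0) (c 2)
    ... | tri≈ _ eq _ | _ | _ = c-distinct {0} {1} (λ ()) eq
    ... | _ | tri≈ _ eq _ | _ = c-distinct {1} {2} (λ ()) eq
    ... | _ | _ | tri≈ _ eq _ = c-distinct {0} {2} (λ ()) eq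
    ... | tri< a _ _ | tri< b _ _ | _          = sorted-absurd {0} {1} {2} (λ ()) (λ ()) (λ ()) a b
    ... | tri< _ _ _ | tri> _ _ b | tri< d _ _ = sorted-absurd {0} {2} {1} (λ ()) (λ ()) (λ ()) d b
    ... | tri< a _ _ | tri> _ _ _ | tri> _ _ d = sorted-absurd {2} {0} {1} (λ ()) (λ ()) (λ ()) d a
    ... | tri> _ _ a | tri< _ _ _ | tri< d _ _ = sorted-absurd {1} {0} {2} (λ ()) (λ ()) (λ ()) a d
    ... | tri> _ _ a | tri< b _ _ | tri> _ _ d = sorted-absurd {1} {2} {0} (λ ()) (λ ()) (λ ()) b d
    ... | tri> _ _ a | tri> _ _ b | _          = sorted-absurd {2} {1} {0} (λ ()) (λ ()) (λ ()) b a

-- Composition of minors and the conclusion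

≼-trans : ∀ {H G K} → H ≼ G → G ≼ K → H ≼ K
≼-trans {H} {G} {K} M N = record
  { branch    = branch
  ; disjoint  = λ (g , i , j) (g′ , i′ , j′) →
      M.disjoint i (subst (M.branch _) (N.disjoint j′ j) i′)
  ; nonempty  = λ h → let g , i = M.nonempty h ; x , j = N.nonempty g in x , g , i , j
  ; connected = λ { h (g , i , j) (g′ , i′ , j′) → lift (M.connected h i i′) j j′ }
  ; edges     = λ e →
      let g , g′ , i , i′ , e′ = M.edges e ; x , y , j , j′ , e″ = N.edges e′
      in x , y , (g , i , j) , (g′ , i′ , j′) , e″
  }
  where
  module M = _≼_ M
  module N = _≼_ N
  branch : V H → V K → Set
  branch h x = ∃ λ g → M.branch h g × N.branch g x
  lift : ∀ {h g g′} → Walk G (M.branch h) (λ _ _ → ⊤) g g′ →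
    ∀ {x y} → N.branch g x → N.branch g′ y → Walk K (branch h) (λ _ _ → ⊤) x y
  lift (stay i) j j′ = widen (λ k → _ , i , k) (N.connected _ j j′)
  lift (step i e _ w) j j′ = let x , y , k , k′ , e′ = N.edges e in
    widen (λ l → _ , i , l) (N.connected _ j k) ▷ step (_ , i , k) e′ tt (lift w k′ j′)

-- Equality on a large type as a small type, so that excluded middle for Set decides it.
data _≡ₛ_ {A : Set₁} (x : A) : A → Set where
  refl : x ≡ₛ x

≡-stable : ExcludedMiddle 0ℓ → {A : Set₁} {x y : A} → ¬ x ≢ y → x ≡ y
≡-stable em {A} {x} {y} nn with em {x ≡ₛ y}
... | yes refl = refl
... | no  n    = ⊥-elim (nn λ { refl → n refl })

theorem2 : ExcludedMiddle 0ℓ →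
    (I : Set₁) (ℋ : I → Graph) →
    (∀ i → InfEdgeConnected (ℋ i)) →
    (∀ G → InfEdgeConnected G → Σ I (λ i → ℋ i ≼ G)) →
    (∀ i j → i ≢ j → ¬ (ℋ i ≼ ℋ j)) →
    Σ I (λ i₁ → Σ I (λ i₂ →
    i₁ ≢ i₂ × (∀ i → i ≡ i₁ ⊎ i ≡ i₂) ×
    (ℋ i₁ ≈m Farey) × (ℋ i₂ ≈m T-ℵ₀*t)))
theorem2 em I ℋ conn below antichain =
  i₁ , i₂ , i₁≢i₂ , only , (H₁≼F , F≼H₁) , (H₂≼T , T≼H₂)
  where
  i₁ i₂ : I
  i₁ = proj₁ (below Farey Farey-connected)
  i₂ = proj₁ (below T-ℵ₀*t T-ℵ₀*t-connected)
  H₁≼F : ℋ i₁ ≼ Farey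
  H₁≼F = proj₂ (below Farey Farey-connected)
  H₂≼T : ℋ i₂ ≼ T-ℵ₀*t
  H₂≼T = proj₂ (below T-ℵ₀*t T-ℵ₀*t-connected)
  F⋠T : ¬ Farey ≼ T-ℵ₀*t
  F⋠T = Crossing.Farey⋠T-ℵ₀*t em
  T⋠F : ¬ T-ℵ₀*t ≼ Farey
  T⋠F = Outerplanar.T-ℵ₀*t⋠Farey em
  contains : ∀ i → Farey ≼ ℋ i ⊎ T-ℵ₀*t ≼ ℋ i
  contains i = Dichotomy.minor em farey-coding (ℋ i) (conn i)
  F≼H₁ : Farey ≼ ℋ i₁
  F≼H₁ = [ id , (λ T≼H → ⊥-elim (T⋠F (≼-trans T≼H H₁≼F))) ]′ (contains i₁)
  T≼H₂ : T-ℵ₀*t ≼ ℋ i₂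
  T≼H₂ = [ (λ F≼H → ⊥-elim (F⋠T (≼-trans F≼H H₂≼T))) , id ]′ (contains i₂)
  i₁≢i₂ : i₁ ≢ i₂
  i₁≢i₂ eq = F⋠T (≼-trans (subst (λ i → Farey ≼ ℋ i) eq F≼H₁) H₂≼T)
  only : ∀ i → i ≡ i₁ ⊎ i ≡ i₂
  only i = Sum.map
    -- Through the Farey graph, `ℋ i₁` is a minor of `ℋ i`, so the antichain condition refutes that
    -- the indices differ.
    (λ F≼H → ≡-stable em λ ne → antichain i₁ i (ne ∘ sym) (≼-trans H₁≼F F≼H))
    (λ T≼H → ≡-stable em λ ne → antichain i₂ i (ne ∘ sym) (≼-trans H₂≼T T≼H))
    (contains i)
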